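{- Let $T$ be the Kari–Culik set of 13 Wang tiles described in the context. Then $T$ tiles the plane and has positive entropy, i.e. $H(T)=\lim_{n\to\infty}\frac{\log C_T(n)}{n^2}>0$, where $C_T(n)$ is the number of distinct $n\times n$ square patterns that occur in at least one tiling of the plane $\mathbb{Z}^2$ by $T$.
   Context: A Wang tile is a unit square with a color on each of its four sides; a tiling of the plane is an assignment of a tile to every cell of $\mathbb{Z}^2$ such that adjacent tiles have equal colors on their common side (no rotations). The limit defining $H(T)$ exists. The Kari–Culik tileset $T$ uses horizontal-edge (top/bottom) colors $0,0',1,2$ and vertical-edge (left/right) colors from two disjoint state sets $\{s_0,s_1\}$ and $\{r_0,r_{1/3},r_{2/3}\}$. Writing a tile as (left, bottom, top, right), the 13 tiles are: $(s_0,0,0',s_0)$, $(s_1,0,0',s_1)$, $(s_0,1,2,s_0)$, $(s_1,1,2,s_1)$, $(s_0,1,1,s_1)$, $(s_1,0,1,s_0)$, $(s_1,0',1,s_0)$, $(r_0,2,1,r_{1/3})$, $(r_{1/3},2,1,r_{2/3})$, $(r_{1/3},1,0,r_0)$, $(r_{2/3},1,0,r_{1/3})$, $(r_0,1,1,r_{2/3})$, $(r_{2/3},2,0,r_0)$. -}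

module Defs where

open import Data.Empty using (⊥)
open import Data.Fin.Base using (Fin; toℕ)
open import Data.Integer.Base as ℤ using (ℤ; +_; -[1+_])
import Data.Integer.Properties as ℤ
open import Data.List.Base using (List; []; _∷_; length)
open import Data.List.Membership.Propositional using (_∈_)
open import Data.List.Relation.Unary.Unique.Propositional using (Unique)
open import Data.Nat.Base as ℕ using (ℕ; zero; suc; NonZero)
import Data.Nat.Properties as ℕ
open import Data.Nat.Solver using (module +-*-Solver)
open import Data.Product.Base using (Σ; ∃; ∃-syntax; _×_; _,_)
open import Data.Rational.Unnormalised.Base as ℚ using (ℚᵘ; mkℚᵘ; 0ℚᵘ; _≃_; *<*)
import Data.Rational.Unnormalised.Properties as ℚ
open import Data.Sum.Base using (_⊎_; inj₁; inj₂)
open import Data.Unit.Base using (⊤; tt)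
open import Data.Vec.Base using (Vec; lookup)
open import Function.Bundles using (_⇔_)
open import Relation.Binary.PropositionalEquality using (_≡_; refl; sym; trans; cong; subst; subst₂)
open import Relation.Nullary using (yes; no)
open import Relation.Nullary.Negation using (contradiction)

------------------------------------------------------------------------
-- Real numbers

-- Dedekind cuts: `lower q` reads "q < x" and `upper q` reads "x < q".

record ℝ : Set₁ where
  field
    lower           : ℚᵘ → Set
    upper           : ℚᵘ → Set
    lower-inhabited : ∃ lower
    upper-inhabited : ∃ upper
    lower-closed    : ∀ {q r} → q ℚ.< r → lower r → lower q
    upper-closed    : ∀ {q r} → q ℚ.< r → upper q → upper r
    lower-open      : ∀ {q} → lower q → ∃[ r ] q ℚ.< r × lower r
    upper-open      : ∀ {q} → upper q → ∃[ r ] r ℚ.< q × upper r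
    disjoint        : ∀ {q} → lower q → upper q → ⊥
    located         : ∀ {q r} → q ℚ.< r → lower q ⊎ upper r

  lower-resp : ∀ {q r} → q ≃ r → lower q → lower r
  lower-resp q≃r lq with lower-open lq
  ... | s , q<s , ls = lower-closed (ℚ.<-respˡ-≃ q≃r q<s) ls

  upper-resp : ∀ {q r} → q ≃ r → upper q → upper r
  upper-resp q≃r uq with upper-open uq
  ... | s , s<q , us = upper-closed (ℚ.<-respʳ-≃ q≃r s<q) us

infix 4 _<_

_<_ : ℝ → ℝ → Set
x < y = ∃[ q ] ℝ.upper x q × ℝ.lower y q

-- The real g⁻¹(x), for g an increasing bijection of the rationals with
-- right inverse h.

module _ (g h : ℚᵘ → ℚᵘ)
         (mono   : ∀ {p q} → p ℚ.< q → g p ℚ.< g q)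
         (cancel : ∀ {p q} → g p ℚ.< g q → p ℚ.< q)
         (gh     : ∀ q → g (h q) ≃ q)
         (x : ℝ) where

  private module X = ℝ x

  preimage : ℝ
  preimage = record
    { lower           = λ q → X.lower (g q)
    ; upper           = λ q → X.upper (g q)
    ; lower-inhabited = let q , lq = X.lower-inhabited
                        in h q , X.lower-resp (ℚ.≃-sym (gh q)) lq
    ; upper-inhabited = let q , uq = X.upper-inhabited
                        in h q , X.upper-resp (ℚ.≃-sym (gh q)) uq
    ; lower-closed    = λ q<r → X.lower-closed (mono q<r)
    ; upper-closed    = λ q<r → X.upper-closed (mono q<r)
    ; lower-open      = λ lq → let r , q<r , lr = X.lower-open lq
                               in h r
                                , cancel (ℚ.<-respʳ-≃ (ℚ.≃-sym (gh r)) q<r)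
                                , X.lower-resp (ℚ.≃-sym (gh r)) lr
    ; upper-open      = λ uq → let r , r<q , ur = X.upper-open uq
                               in h r
                                , cancel (ℚ.<-respˡ-≃ (ℚ.≃-sym (gh r)) r<q)
                                , X.upper-resp (ℚ.≃-sym (gh r)) ur
    ; disjoint        = X.disjoint
    ; located         = λ q<r → X.located (mono q<r)
    }

private
  +-−-cancel : ∀ p q → p ℚ.+ q ℚ.- q ≃ p
  +-−-cancel p q = ℚ.≃-trans (ℚ.+-assoc p q (ℚ.- q))
    (ℚ.≃-trans (ℚ.+-congʳ p (ℚ.+-inverseʳ q)) (ℚ.+-identityʳ p))

  −-+-cancel : ∀ p q → p ℚ.- q ℚ.+ q ≃ p
  −-+-cancel p q = ℚ.≃-trans (ℚ.+-assoc p (ℚ.- q) q)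
    (ℚ.≃-trans (ℚ.+-congʳ p (ℚ.+-inverseˡ q)) (ℚ.+-identityʳ p))

infixl 6 _⊕_ _⊖_

-- q < x + ε  iff  q − ε < x

_⊕_ : ℝ → ℚᵘ → ℝ
x ⊕ ε = preimage (ℚ._- ε) (ℚ._+ ε) (ℚ.+-monoˡ-< (ℚ.- ε)) cancel
          (λ q → +-−-cancel q ε) x
  where
  cancel : ∀ {p q} → p ℚ.- ε ℚ.< q ℚ.- ε → p ℚ.< q
  cancel {p} {q} lt = ℚ.<-respˡ-≃ (−-+-cancel p ε)
    (ℚ.<-respʳ-≃ (−-+-cancel q ε) (ℚ.+-monoˡ-< ε lt))

_⊖_ : ℝ → ℚᵘ → ℝ
x ⊖ ε = x ⊕ (ℚ.- ε)

infixl 7 _÷_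

-- q < x / m  iff  q · m < x

_÷_ : ℝ → (m : ℕ) .{{_ : NonZero m}} → ℝ
x ÷ suc m = preimage (ℚ._* M) (ℚ._* ℚ.1/ M) (ℚ.*-monoˡ-<-pos M)
              (ℚ.*-cancelʳ-<-nonNeg M)
              (λ q → ℚ.≃-trans (ℚ.*-assoc q (ℚ.1/ M) M)
                 (ℚ.≃-trans (ℚ.*-congˡ {q} (ℚ.*-inverseˡ M)) (ℚ.*-identityʳ q)))
              x
  where
  M : ℚᵘ
  M = mkℚᵘ (+ suc m) 0

------------------------------------------------------------------------
-- Binary logarithm of a positive natural number

-- p/d < log₂ c  iff  2 ^ p < c ^ d, and log₂ c < p/d  iff  c ^ d < 2 ^ p;
-- a negative rational lies below log₂ c because c ≥ 1.

module Log₂ (c : ℕ) where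

  Lower Upper : ℚᵘ → Set
  Lower (mkℚᵘ (+ p)    d-1) = 2 ℕ.^ p ℕ.< c ℕ.^ suc d-1
  Lower (mkℚᵘ -[1+ _ ] _  ) = ⊤
  Upper (mkℚᵘ (+ p)    d-1) = c ℕ.^ suc d-1 ℕ.< 2 ℕ.^ p
  Upper (mkℚᵘ -[1+ _ ] _  ) = ⊥

private
  n<2^n : ∀ n → n ℕ.< 2 ℕ.^ n
  n<2^n zero    = ℕ.s≤s ℕ.z≤n
  n<2^n (suc n) = begin-strict
    suc n                       <⟨ ℕ.s<s (n<2^n n) ⟩
    1 ℕ.+ 2 ℕ.^ n               ≤⟨ ℕ.+-monoˡ-≤ _ (ℕ.m^n>0 2 n) ⟩
    2 ℕ.^ n ℕ.+ 2 ℕ.^ n         ≡⟨ cong (2 ℕ.^ n ℕ.+_) (ℕ.+-identityʳ _) ⟨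
    2 ℕ.^ suc n                 ∎
    where open ℕ.≤-Reasoning

  bernoulli : ∀ a k → a ℕ.^ suc k ℕ.+ suc k ℕ.* a ℕ.^ k ℕ.≤ suc a ℕ.^ suc k
  bernoulli a zero    = ℕ.≤-reflexive (lemma a)
    where
    open +-*-Solver
    lemma : ∀ a → a ℕ.* 1 ℕ.+ 1 ℕ.* 1 ≡ suc a ℕ.* 1
    lemma = solve 1 (λ a → a :* con 1 :+ con 1 :* con 1
                             := (con 1 :+ a) :* con 1) refl
  bernoulli a (suc k) = begin
    a ℕ.* (a ℕ.* A) ℕ.+ suc (suc k) ℕ.* (a ℕ.* A)
      ≤⟨ ℕ.m≤m+n _ (suc k ℕ.* A) ⟩
    a ℕ.* (a ℕ.* A) ℕ.+ suc (suc k) ℕ.* (a ℕ.* A) ℕ.+ suc k ℕ.* A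
      ≡⟨ lemma a A k ⟩
    suc a ℕ.* (a ℕ.* A ℕ.+ suc k ℕ.* A)
      ≤⟨ ℕ.*-monoʳ-≤ (suc a) (bernoulli a k) ⟩
    suc a ℕ.* suc a ℕ.^ suc k ∎
    where
    open ℕ.≤-Reasoning
    open +-*-Solver
    A = a ℕ.^ k
    lemma : ∀ a A k → a ℕ.* (a ℕ.* A) ℕ.+ suc (suc k) ℕ.* (a ℕ.* A) ℕ.+ suc k ℕ.* A
                    ≡ suc a ℕ.* (a ℕ.* A ℕ.+ suc k ℕ.* A)
    lemma = solve 3 (λ a A k →
      a :* (a :* A) :+ (con 2 :+ k) :* (a :* A) :+ (con 1 :+ k) :* A
        := (con 1 :+ a) :* (a :* A :+ (con 1 :+ k) :* A)) refl

  -- the witness for the cuts being open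
  gap : ∀ a b → 0 ℕ.< a → a ℕ.< b → 2 ℕ.* a ℕ.^ suc a ℕ.< b ℕ.^ suc a
  gap a@(suc _) b _ a<b = begin-strict
    2 ℕ.* (a ℕ.* A)             ≡⟨ cong (a ℕ.* A ℕ.+_) (ℕ.+-identityʳ _) ⟩
    a ℕ.* A ℕ.+ a ℕ.* A         <⟨ ℕ.+-monoʳ-< (a ℕ.* A)
                                     (ℕ.*-monoˡ-< A {{ℕ.m^n≢0 a a}} (ℕ.n<1+n a)) ⟩
    a ℕ.* A ℕ.+ suc a ℕ.* A     ≤⟨ bernoulli a a ⟩
    suc a ℕ.^ suc a             ≤⟨ ℕ.^-monoˡ-≤ (suc a) a<b ⟩
    b ℕ.^ suc a                 ∎
    where
    open ℕ.≤-Reasoning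
    A = a ℕ.^ a

  ^-cancelˡ-< : ∀ {m o} n → m ℕ.^ n ℕ.< o ℕ.^ n → m ℕ.< o
  ^-cancelˡ-< n lt = ℕ.≰⇒> (λ o≤m → ℕ.<⇒≱ lt (ℕ.^-monoˡ-≤ n o≤m))

  cross : ∀ {p p′ d d′} → mkℚᵘ (+ p) d ℚ.< mkℚᵘ (+ p′) d′ →
          p ℕ.* suc d′ ℕ.< p′ ℕ.* suc d
  cross {p} {p′} {d} {d′} (*<* lt) = ℤ.drop‿+<+
    (subst₂ ℤ._<_ (sym (ℤ.pos-* p (suc d′))) (sym (ℤ.pos-* p′ (suc d))) lt)

  uncross : ∀ {p p′ d d′} → p ℕ.* suc d′ ℕ.< p′ ℕ.* suc d →
            mkℚᵘ (+ p) d ℚ.< mkℚᵘ (+ p′) d′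
  uncross {p} {p′} {d} {d′} lt = *<*
    (subst₂ ℤ._<_ (ℤ.pos-* p (suc d′)) (ℤ.pos-* p′ (suc d)) (ℤ.+<+ lt))

  pow-swap : ∀ c m n → (c ℕ.^ m) ℕ.^ n ≡ (c ℕ.^ n) ℕ.^ m
  pow-swap c m n = trans (ℕ.^-*-assoc c m n)
    (trans (cong (c ℕ.^_) (ℕ.*-comm m n)) (sym (ℕ.^-*-assoc c n m)))

  module _ (c : ℕ) .{{_ : NonZero c}} where
    open Log₂ c

    open ℕ.≤-Reasoning

    2^-cross : ∀ {p p′ d d′} → mkℚᵘ (+ p) d ℚ.< mkℚᵘ (+ p′) d′ →
               (2 ℕ.^ p) ℕ.^ suc d′ ℕ.< (2 ℕ.^ p′) ℕ.^ suc d
    2^-cross {p} {p′} {d} {d′} lt =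
      subst₂ ℕ._<_ (sym (ℕ.^-*-assoc 2 p (suc d′))) (sym (ℕ.^-*-assoc 2 p′ (suc d)))
        (ℕ.^-monoʳ-< 2 (ℕ.s≤s (ℕ.s≤s ℕ.z≤n)) (cross lt))

    closedˡ : ∀ {q r} → q ℚ.< r → Lower r → Lower q
    closedˡ {mkℚᵘ -[1+ _ ] _} _ _ = tt
    closedˡ {mkℚᵘ (+ p) d} {mkℚᵘ (+ p′) d′} q<r l = ^-cancelˡ-< (suc d′) (begin-strict
      (2 ℕ.^ p) ℕ.^ suc d′      <⟨ 2^-cross q<r ⟩
      (2 ℕ.^ p′) ℕ.^ suc d      ≤⟨ ℕ.^-monoˡ-≤ (suc d) (ℕ.<⇒≤ l) ⟩
      (c ℕ.^ suc d′) ℕ.^ suc d  ≡⟨ pow-swap c (suc d′) (suc d) ⟩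
      (c ℕ.^ suc d) ℕ.^ suc d′  ∎)
    closedˡ {mkℚᵘ (+ zero) d}    {mkℚᵘ -[1+ _ ] d′} (*<* ()) _
    closedˡ {mkℚᵘ (+ suc p) d}   {mkℚᵘ -[1+ _ ] d′} (*<* ()) _

    closedᵘ : ∀ {q r} → q ℚ.< r → Upper q → Upper r
    closedᵘ {mkℚᵘ (+ p) d} {mkℚᵘ (+ p′) d′} q<r u = ^-cancelˡ-< (suc d) (begin-strict
      (c ℕ.^ suc d′) ℕ.^ suc d  ≡⟨ pow-swap c (suc d′) (suc d) ⟩
      (c ℕ.^ suc d) ℕ.^ suc d′  ≤⟨ ℕ.^-monoˡ-≤ (suc d′) (ℕ.<⇒≤ u) ⟩
      (2 ℕ.^ p) ℕ.^ suc d′      <⟨ 2^-cross q<r ⟩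
      (2 ℕ.^ p′) ℕ.^ suc d      ∎)
    closedᵘ {mkℚᵘ (+ zero) d}    {mkℚᵘ -[1+ _ ] d′} (*<* ()) _
    closedᵘ {mkℚᵘ (+ suc p) d}   {mkℚᵘ -[1+ _ ] d′} (*<* ()) _

    openˡ : ∀ {q} → Lower q → ∃[ r ] q ℚ.< r × Lower r
    openˡ {mkℚᵘ -[1+ n ] d} _ = mkℚᵘ -[1+ n ] (suc d) ,
      *<* (ℤ.-<- (ℕ.s≤s (ℕ.+-monoʳ-≤ d (ℕ.*-monoʳ-≤ n (ℕ.n≤1+n (suc d)))))) , tt
    openˡ {mkℚᵘ (+ p) d} l = mkℚᵘ (+ suc (p ℕ.* K)) (a ℕ.+ d ℕ.* K) ,
      uncross (begin-strict
        p ℕ.* (suc d ℕ.* K)        ≡⟨ lemma p (suc d) K ⟩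
        p ℕ.* K ℕ.* suc d          <⟨ ℕ.*-monoˡ-< (suc d) (ℕ.n<1+n (p ℕ.* K)) ⟩
        suc (p ℕ.* K) ℕ.* suc d    ∎) ,
      (begin-strict
        2 ℕ.* 2 ℕ.^ (p ℕ.* K)      ≡⟨ cong (2 ℕ.*_) (ℕ.^-*-assoc 2 p K) ⟨
        2 ℕ.* (2 ℕ.^ p) ℕ.^ K      <⟨ gap a (c ℕ.^ suc d) (ℕ.m^n>0 2 p) l ⟩
        (c ℕ.^ suc d) ℕ.^ K        ≡⟨ ℕ.^-*-assoc c (suc d) K ⟩
        c ℕ.^ (suc d ℕ.* K)        ∎)
      where
      open +-*-Solver
      a = 2 ℕ.^ p
      K = suc a
      lemma : ∀ p d K → p ℕ.* (d ℕ.* K) ≡ p ℕ.* K ℕ.* d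
      lemma = solve 3 (λ p d K → p :* (d :* K) := p :* K :* d) refl

    openᵘ : ∀ {q} → Upper q → ∃[ r ] r ℚ.< q × Upper r
    openᵘ {mkℚᵘ (+ zero) d} u = contradiction (ℕ.m^n>0 c (suc d)) (ℕ.<⇒≱ u)
    openᵘ {mkℚᵘ (+ suc p) d} u = mkℚᵘ (+ n) (a ℕ.+ d ℕ.* K) ,
      uncross (begin-strict
        n ℕ.* suc d                <⟨ ℕ.*-monoˡ-< (suc d) (ℕ.n<1+n n) ⟩
        suc p ℕ.* K ℕ.* suc d      ≡⟨ lemma (suc p) (suc d) K ⟩
        suc p ℕ.* (suc d ℕ.* K)    ∎) ,
      ℕ.*-cancelˡ-< 2 _ _ (begin-strict
        2 ℕ.* c ℕ.^ (suc d ℕ.* K)  ≡⟨ cong (2 ℕ.*_) (ℕ.^-*-assoc c (suc d) K) ⟨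
        2 ℕ.* (c ℕ.^ suc d) ℕ.^ K  <⟨ gap a (2 ℕ.^ suc p) (ℕ.m^n>0 c (suc d)) u ⟩
        (2 ℕ.^ suc p) ℕ.^ K        ≡⟨ ℕ.^-*-assoc 2 (suc p) K ⟩
        2 ℕ.* 2 ℕ.^ n              ∎)
      where
      open +-*-Solver
      a = c ℕ.^ suc d
      K = suc a
      n = a ℕ.+ p ℕ.* K
      lemma : ∀ p d K → p ℕ.* K ℕ.* d ≡ p ℕ.* (d ℕ.* K)
      lemma = solve 3 (λ p d K → p :* K :* d := p :* (d :* K)) refl

    disj : ∀ {q} → Lower q → Upper q → ⊥
    disj {mkℚᵘ (+ _) _} l u = ℕ.<-asym l u

    loc : ∀ {q r} → q ℚ.< r → Lower q ⊎ Upper r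
    loc {mkℚᵘ -[1+ _ ] _} _ = inj₁ tt
    loc {mkℚᵘ (+ zero) d}    {mkℚᵘ -[1+ _ ] d′} (*<* ())
    loc {mkℚᵘ (+ suc p) d}   {mkℚᵘ -[1+ _ ] d′} (*<* ())
    loc {mkℚᵘ (+ p) d} {mkℚᵘ (+ p′) d′} q<r with 2 ℕ.^ p ℕ.<? c ℕ.^ suc d
    ... | yes l  = inj₁ l
    ... | no  ¬l = inj₂ (^-cancelˡ-< (suc d) (begin-strict
      (c ℕ.^ suc d′) ℕ.^ suc d  ≡⟨ pow-swap c (suc d′) (suc d) ⟩
      (c ℕ.^ suc d) ℕ.^ suc d′  ≤⟨ ℕ.^-monoˡ-≤ (suc d′) (ℕ.≮⇒≥ ¬l) ⟩
      (2 ℕ.^ p) ℕ.^ suc d′      <⟨ 2^-cross q<r ⟩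
      (2 ℕ.^ p′) ℕ.^ suc d      ∎))

log₂ : (c : ℕ) .{{_ : NonZero c}} → ℝ
log₂ c = record
  { lower           = Log₂.Lower c
  ; upper           = Log₂.Upper c
  ; lower-inhabited = mkℚᵘ -[1+ 0 ] 0 , tt
  ; upper-inhabited = mkℚᵘ (+ c) 0 ,
                      subst (ℕ._< 2 ℕ.^ c) (sym (ℕ.^-identityʳ c)) (n<2^n c)
  ; lower-closed    = λ {q} {r} → closedˡ c {q} {r}
  ; upper-closed    = λ {q} {r} → closedᵘ c {q} {r}
  ; lower-open      = λ {q} → openˡ c {q}
  ; upper-open      = λ {q} → openᵘ c {q}
  ; disjoint        = λ {q} → disj c {q}
  ; located         = λ {q} {r} → loc c {q} {r}
  }

------------------------------------------------------------------------
-- Limits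

infix 4 _⟶_

_⟶_ : (ℕ → ℝ) → ℝ → Set
a ⟶ x = ∀ (ε : ℚᵘ) → 0ℚᵘ ℚ.< ε →
        ∃[ N ] ∀ n → N ℕ.≤ n → (x ⊖ ε < a n) × (a n < x ⊕ ε)

Positive : ℝ → Set
Positive x = ℝ.lower x 0ℚᵘ

------------------------------------------------------------------------
-- Wang tiles

record WangTile (V H : Set) : Set where
  constructor tile
  field
    left   : V
    bottom : H
    top    : H
    right  : V

open WangTile public

-- The predicate P holds of exactly c elements.

HasCardinality : {A : Set} → (A → Set) → ℕ → Set
HasCardinality P c = ∃[ xs ] Unique xs × (∀ x → x ∈ xs ⇔ P x) × length xs ≡ c

module _ {V H : Set} (T : List (WangTile V H)) where

  -- The first coordinate increases to the right, the second upwards.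

  record IsTiling (f : ℤ → ℤ → WangTile V H) : Set where
    field
      inT        : ∀ x y → f x y ∈ T
      horizontal : ∀ x y → right (f x y) ≡ left (f (ℤ.suc x) y)
      vertical   : ∀ x y → top (f x y) ≡ bottom (f x (ℤ.suc y))

  TilesPlane : Set
  TilesPlane = ∃[ f ] IsTiling f

  -- A square pattern is a vector of rows, the bottom row coming first.

  Occurs : (n : ℕ) → Vec (Vec (WangTile V H) n) n → Set
  Occurs n P = ∃[ f ] IsTiling f × ∃[ x ] ∃[ y ] ∀ (i j : Fin n) →
    lookup (lookup P j) i ≡ f (x ℤ.+ + toℕ i) (y ℤ.+ + toℕ j)

  -- h = lim log C(n) / n², where C(n) counts the occurring n × n patterns.
  -- The sequence is indexed from n = 1.  The C(n) are required to be nonzero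
  -- for their logarithms to be defined; they are whenever T tiles the plane.
  -- Logarithms are binary: another base only rescales h by a positive factor.

  IsEntropy : ℝ → Set
  IsEntropy h = Σ (ℕ → ℕ) λ C → Σ (∀ n → NonZero (C n)) λ C≢0 →
    (∀ n → HasCardinality (Occurs n) (C n)) ×
    ((λ n → log₂ (C (suc n)) {{C≢0 (suc n)}} ÷ (suc n ℕ.* suc n)) ⟶ h)

------------------------------------------------------------------------
-- The Kari–Culik tileset

data HColor : Set where
  0ʰ 0′ 1ʰ 2ʰ : HColor

data VColor : Set where
  s₀ s₁ r₀ r⅓ r⅔ : VColor

KariCulik : List (WangTile VColor HColor)
KariCulik =
  tile s₀ 0ʰ 0′ s₀ ∷
  tile s₁ 0ʰ 0′ s₁ ∷
  tile s₀ 1ʰ 2ʰ s₀ ∷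
  tile s₁ 1ʰ 2ʰ s₁ ∷
  tile s₀ 1ʰ 1ʰ s₁ ∷
  tile s₁ 0ʰ 1ʰ s₀ ∷
  tile s₁ 0′ 1ʰ s₀ ∷
  tile r₀ 2ʰ 1ʰ r⅓ ∷
  tile r⅓ 2ʰ 1ʰ r⅔ ∷
  tile r⅓ 1ʰ 0ʰ r₀ ∷
  tile r⅔ 1ʰ 0ʰ r⅓ ∷
  tile r₀ 1ʰ 1ʰ r⅔ ∷
  tile r⅔ 2ʰ 0ʰ r₀ ∷
  []

{-# OPTIONS --safe #-}
-- A row of slope x ∈ [1/3,2) consists of the heights ⌊n x⌋; their increments are the horizontal
-- colours.  Rows are doubled when x < 1 and divided by 3 otherwise, and the remainders modulo 2
-- or 3 of the larger heights are the vertical colours; every tile of T states one Euclidean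
-- division compatible with these increments.  Iterating in both directions from x = 1 tiles the
-- plane.  In a row of slope in [1,2), a single height may be changed by 1 without disturbing the
-- rows below and above, provided its quotients by 2 and by 3 are kept and the increments stay in
-- {1,2}.  Rows of slope in [3/2,16/9] recur within 13 rows and contain such a place within any 10
-- consecutive columns, so there is one in every 16 × 16 block and C(16 m) ≥ 2^(m²).  As C is
-- submultiplicative under cutting squares into blocks, log C(n) / n² tends to its infimum.
module Submission where

open import Defs
open import Axiom.ExcludedMiddle using (ExcludedMiddle)
open import Data.Bool.Base using (Bool; true; false)
import Data.Bool.Properties as Bool
open import Data.Empty using (⊥)
open import Data.Fin.Base using (Fin; toℕ; fromℕ<; inject≤; remQuot)
  renaming (zero to 0F; suc to sucF)
import Data.Fin.Properties as Fin
open import Data.Integer.Base as ℤ using (ℤ; +_; -[1+_])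
import Data.Integer.DivMod as ℤ
import Data.Integer.Properties as ℤ
import Data.Integer.Tactic.RingSolver as ℤRing
open import Data.List.Base
  using (List; []; _∷_; _++_; length; map; cartesianProductWith; filter; deduplicate)
import Data.List.Membership.DecPropositional as Dec∈
open import Data.List.Membership.Propositional using (_∈_)
open import Data.List.Membership.Propositional.Properties
  using ( ∈-++⁻; ∈-++⁺ˡ; ∈-++⁺ʳ; ∈-∃++; ∈-cartesianProductWith⁺; ∈-filter⁺; ∈-filter⁻; ∈-deduplicate⁺
        ; ∈-length; ∈-map⁺; ∈-map⁻)
import Data.List.Properties as List
import Data.List.Relation.Unary.All as All
open import Data.List.Relation.Unary.Any using (here; there)
open import Data.List.Relation.Unary.Unique.Propositional using (Unique; []; _∷_)
import Data.List.Relation.Unary.Unique.DecPropositional.Properties as DecUnique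
import Data.List.Relation.Unary.Unique.Propositional.Properties as Unique
open import Data.Nat.Base as ℕ using (ℕ; zero; suc; NonZero)
import Data.Nat.Divisibility as ℕ
import Data.Nat.DivMod as ℕ
import Data.Nat.Properties as ℕ
import Data.Nat.Tactic.RingSolver as ℕRing
open import Data.Product.Base using (∃-syntax; _×_; _,_; proj₁; proj₂)
open import Data.Rational.Unnormalised.Base as ℚ
  using (ℚᵘ; mkℚᵘ; 0ℚᵘ; 1ℚᵘ; ½; _≃_; *≡*; *<*)
import Data.Rational.Unnormalised.Properties as ℚ
open import Data.Sum.Base using (_⊎_; inj₁; inj₂)
open import Data.Vec.Base as Vec using (Vec; []; _∷_; lookup; tabulate)
import Data.Vec.Properties as Vec
open import Function.Base using (_∘_)
open import Function.Bundles using (mk⇔)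
open import Level using (0ℓ)
open import Relation.Binary.Definitions using (DecidableEquality)
open import Relation.Binary.PropositionalEquality
open import Relation.Nullary using (¬_; Dec; yes; no)
open import Relation.Nullary.Decidable
  using (True; toWitness; from-yes; map′; _×-dec_; _→-dec_)
open import Relation.Nullary.Negation using (contradiction)
open import Relation.Unary using (Decidable)

-- Tiles from integer heights

-- The window [3/2,16/9] is dictated by the heights that can be changed. From slope 3/2 on, two
-- consecutive increments sum to at least 3, so every increment 1 has increments 2 on both sides and
-- leaves room to move a height; near slope 1 it would not. Up to slope 16/9, nine increments sum to
-- at most 16, whereas nine columns in which no odd height is followed by an increment 1 climb at
-- least 17; near slope 2 such places become too rare. An odd height v followed by v + 1 is what is
-- sought: v and v - 1 have the same half, as do v + 1 and v + 2, and the residue of v modulo 3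
-- decides which of the two changes also keeps the third.

≟-retract : {X : Set} (code : X → ℕ) (decode : ℕ → X) →
            (∀ x → decode (code x) ≡ x) → DecidableEquality X
≟-retract code decode inv x y = map′
  (λ eq → trans (sym (inv x)) (trans (cong decode eq) (inv y))) (cong code)
  (code x ℕ.≟ code y)

infix 4 _≟ᵛ_ _≟ʰ_ _≟ᵗ_

_≟ᵛ_ : DecidableEquality VColor
_≟ᵛ_ = ≟-retract
  (λ { s₀ → 0 ; s₁ → 1 ; r₀ → 2 ; r⅓ → 3 ; r⅔ → 4 })
  (λ { 0 → s₀ ; 1 → s₁ ; 2 → r₀ ; 3 → r⅓ ; _ → r⅔ })
  (λ { s₀ → refl ; s₁ → refl ; r₀ → refl ; r⅓ → refl ; r⅔ → refl })

_≟ʰ_ : DecidableEquality HColor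
_≟ʰ_ = ≟-retract
  (λ { 0ʰ → 0 ; 0′ → 1 ; 1ʰ → 2 ; 2ʰ → 3 })
  (λ { 0 → 0ʰ ; 1 → 0′ ; 2 → 1ʰ ; _ → 2ʰ })
  (λ { 0ʰ → refl ; 0′ → refl ; 1ʰ → refl ; 2ʰ → refl })

_≟ᵗ_ : DecidableEquality (WangTile VColor HColor)
tile l b t r ≟ᵗ tile l′ b′ t′ r′ =
  map′ (λ { (refl , refl , refl , refl) → refl }) (λ { refl → refl , refl , refl , refl })
    (l ≟ᵛ l′ ×-dec b ≟ʰ b′ ×-dec t ≟ʰ t′ ×-dec r ≟ᵛ r′)

open Dec∈ _≟ᵗ_ using (_∈?_)

-- Rows of slope in [1/3,2/3), [2/3,1) and [1,2) respectively; exactly the zeros of a B row are 0′.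
data Kind : Set where
  A B C : Kind

base : Kind → ℕ
base A = 0
base B = 0
base C = 1

-- u ≤ v < u + M, with the remainder v − u as data: it will be the colour of an edge.
Near : ℕ → ℤ → ℤ → Set
Near M u v = ∃[ e ] v ≡ u ℤ.+ + toℕ {M} e

Inc : Kind → ℤ → ℤ → Set
Inc k a b = Near 2 (+ base k ℤ.+ a) b

-- These are the steps of the slope map: [1/3,1/2) doubles into B, [1/2,2/3) and B double into C,
-- and a third of C lies in A. That C-C is empty later shows that changed rows are never adjacent.
Link : Kind → Kind → ℤ → ℤ → Set
Link A B a a′ = Near 2 (+ 2 ℤ.* a) a′
Link A C a a′ = Near 2 (+ 2 ℤ.* a) a′
Link B C a a′ = Near 2 (+ 2 ℤ.* a) a′
Link C A a a′ = Near 3 (+ 3 ℤ.* a′) a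
Link _ _ _ _  = ⊥

hcol : Kind → Fin 2 → HColor
hcol A 0F        = 0ʰ
hcol A (sucF 0F) = 1ʰ
hcol B 0F        = 0′
hcol B (sucF 0F) = 1ʰ
hcol C 0F        = 1ʰ
hcol C (sucF 0F) = 2ʰ

-- A carry is the negative of a remainder, up to a constant: s_i is 1 − i and r_k is 2 − 3 k.

scol : Fin 2 → VColor
scol 0F        = s₁
scol (sucF 0F) = s₀

rcol : Fin 3 → VColor
rcol 0F               = r⅔
rcol (sucF 0F)        = r⅓
rcol (sucF (sucF 0F)) = r₀

vcol : ∀ k k′ {a a′} → Link k k′ a a′ → VColor
vcol A B l = scol (proj₁ l)
vcol A C l = scol (proj₁ l)
vcol B C l = scol (proj₁ l)
vcol C A l = rcol (proj₁ l)

hcol-injective : ∀ k {d d′} → hcol k d ≡ hcol k d′ → d ≡ d′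
hcol-injective A {0F} {0F} _ = refl
hcol-injective A {sucF 0F} {sucF 0F} _ = refl
hcol-injective A {0F} {sucF 0F} ()
hcol-injective A {sucF 0F} {0F} ()
hcol-injective B {0F} {0F} _ = refl
hcol-injective B {sucF 0F} {sucF 0F} _ = refl
hcol-injective B {0F} {sucF 0F} ()
hcol-injective B {sucF 0F} {0F} ()
hcol-injective C {0F} {0F} _ = refl
hcol-injective C {sucF 0F} {sucF 0F} _ = refl
hcol-injective C {0F} {sucF 0F} ()
hcol-injective C {sucF 0F} {0F} ()

-- Subtracting the doubling equations of two neighbouring heights leaves this balance between the
-- four edges of a tile. It involves finitely many values, so membership in `KariCulik` is settled
-- by running through them.
STile : Kind → Kind → Set
STile k k′ = ∀ (d d′ e e′ : Fin 2) →
  2 ℕ.* (base k ℕ.+ toℕ d) ℕ.+ toℕ e′ ≡ toℕ e ℕ.+ (base k′ ℕ.+ toℕ d′) →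
  tile (scol e) (hcol k d) (hcol k′ d′) (scol e′) ∈ KariCulik

stile? : ∀ k k′ → Dec (STile k k′)
stile? k k′ = Fin.all? λ d → Fin.all? λ d′ → Fin.all? λ e → Fin.all? λ e′ →
  (_ ℕ.≟ _) →-dec (_ ∈? _)

RTile : Set
RTile = ∀ (d d′ : Fin 2) (e e′ : Fin 3) →
  3 ℕ.* toℕ d′ ℕ.+ toℕ e′ ≡ toℕ e ℕ.+ (1 ℕ.+ toℕ d) →
  tile (rcol e) (hcol C d) (hcol A d′) (rcol e′) ∈ KariCulik

rtile : RTile
rtile = from-yes {A = RTile} (Fin.all? λ d → Fin.all? λ d′ → Fin.all? λ e → Fin.all? λ e′ →
  (_ ℕ.≟ _) →-dec (_ ∈? _))

s-balance : ∀ {a b a′ b′} β d β′ d′ e e′ →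
  b ≡ (+ β ℤ.+ a) ℤ.+ + d → b′ ≡ (+ β′ ℤ.+ a′) ℤ.+ + d′ →
  a′ ≡ + 2 ℤ.* a ℤ.+ + e → b′ ≡ + 2 ℤ.* b ℤ.+ + e′ →
  2 ℕ.* (β ℕ.+ d) ℕ.+ e′ ≡ e ℕ.+ (β′ ℕ.+ d′)
s-balance {a} β d β′ d′ e e′ refl b′≡ refl b′≡₂ = ℤ.+-injective (begin
  + (2 ℕ.* (β ℕ.+ d) ℕ.+ e′)           ≡⟨ cong (ℤ._+ + e′) (ℤ.pos-* 2 (β ℕ.+ d)) ⟩
  + 2 ℤ.* (+ β ℤ.+ + d) ℤ.+ + e′       ≡⟨ lhs a (+ β) (+ d) (+ e′) ⟩
  (+ 2 ℤ.* ((+ β ℤ.+ a) ℤ.+ + d) ℤ.+ + e′) ℤ.- + 2 ℤ.* a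
    ≡⟨ cong (ℤ._- + 2 ℤ.* a) (trans (sym b′≡₂) b′≡) ⟩
  ((+ β′ ℤ.+ (+ 2 ℤ.* a ℤ.+ + e)) ℤ.+ + d′) ℤ.- + 2 ℤ.* a
    ≡⟨ rhs a (+ β′) (+ d′) (+ e) ⟩
  + e ℤ.+ (+ β′ ℤ.+ + d′)              ∎)
  where
  open ≡-Reasoning
  lhs : ∀ a β d e′ → + 2 ℤ.* (β ℤ.+ d) ℤ.+ e′ ≡ (+ 2 ℤ.* ((β ℤ.+ a) ℤ.+ d) ℤ.+ e′) ℤ.- + 2 ℤ.* a
  lhs = ℤRing.solve-∀
  rhs : ∀ a β′ d′ e → ((β′ ℤ.+ (+ 2 ℤ.* a ℤ.+ e)) ℤ.+ d′) ℤ.- + 2 ℤ.* a ≡ e ℤ.+ (β′ ℤ.+ d′)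
  rhs = ℤRing.solve-∀

r-balance : ∀ {a b a′ b′} d d′ e e′ →
  b ≡ (+ 1 ℤ.+ a) ℤ.+ + d → b′ ≡ (+ 0 ℤ.+ a′) ℤ.+ + d′ →
  a ≡ + 3 ℤ.* a′ ℤ.+ + e → b ≡ + 3 ℤ.* b′ ℤ.+ + e′ →
  3 ℕ.* d′ ℕ.+ e′ ≡ e ℕ.+ (1 ℕ.+ d)
r-balance {a′ = a′} d d′ e e′ b≡ refl refl b≡₂ = ℤ.+-injective (begin
  + (3 ℕ.* d′ ℕ.+ e′)           ≡⟨ cong (ℤ._+ + e′) (ℤ.pos-* 3 d′) ⟩
  + 3 ℤ.* + d′ ℤ.+ + e′         ≡⟨ lhs a′ (+ d′) (+ e′) ⟩
  (+ 3 ℤ.* ((+ 0 ℤ.+ a′) ℤ.+ + d′) ℤ.+ + e′) ℤ.- + 3 ℤ.* a′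
    ≡⟨ cong (ℤ._- + 3 ℤ.* a′) (trans (sym b≡₂) b≡) ⟩
  ((+ 1 ℤ.+ (+ 3 ℤ.* a′ ℤ.+ + e)) ℤ.+ + d) ℤ.- + 3 ℤ.* a′
    ≡⟨ rhs a′ (+ d) (+ e) ⟩
  + e ℤ.+ (+ 1 ℤ.+ + d)         ∎)
  where
  open ≡-Reasoning
  lhs : ∀ a d′ e′ → + 3 ℤ.* d′ ℤ.+ e′ ≡ (+ 3 ℤ.* ((+ 0 ℤ.+ a) ℤ.+ d′) ℤ.+ e′) ℤ.- + 3 ℤ.* a
  lhs = ℤRing.solve-∀
  rhs : ∀ a d e → ((+ 1 ℤ.+ (+ 3 ℤ.* a ℤ.+ e)) ℤ.+ d) ℤ.- + 3 ℤ.* a ≡ e ℤ.+ (+ 1 ℤ.+ d)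
  rhs = ℤRing.solve-∀

cell-∈ : ∀ k k′ {a b a′ b′} (i : Inc k a b) (i′ : Inc k′ a′ b′)
         (l : Link k k′ a a′) (l′ : Link k k′ b b′) →
         tile (vcol k k′ l) (hcol k (proj₁ i)) (hcol k′ (proj₁ i′)) (vcol k k′ l′) ∈ KariCulik
cell-∈ A B {a} (d , p) (d′ , p′) (e , q) (e′ , q′) =
  from-yes (stile? A B) d d′ e e′ (s-balance {a} 0 (toℕ d) 0 (toℕ d′) (toℕ e) (toℕ e′) p p′ q q′)
cell-∈ A C {a} (d , p) (d′ , p′) (e , q) (e′ , q′) =
  from-yes (stile? A C) d d′ e e′ (s-balance {a} 0 (toℕ d) 1 (toℕ d′) (toℕ e) (toℕ e′) p p′ q q′)
cell-∈ B C {a} (d , p) (d′ , p′) (e , q) (e′ , q′) =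
  from-yes (stile? B C) d d′ e e′ (s-balance {a} 0 (toℕ d) 1 (toℕ d′) (toℕ e) (toℕ e′) p p′ q q′)
cell-∈ C A {a′ = a′} (d , p) (d′ , p′) (e , q) (e′ , q′) =
  rtile d d′ e e′ (r-balance {a′ = a′} (toℕ d) (toℕ d′) (toℕ e) (toℕ e′) p p′ q q′)

record Height (kind : ℤ → Kind) : Set where
  field
    val  : ℤ → ℤ → ℤ
    inc  : ∀ y x → Inc (kind y) (val y x) (val y (ℤ.suc x))
    link : ∀ y x → Link (kind y) (kind (ℤ.suc y)) (val y x) (val (ℤ.suc y) x)

  cell : ℤ → ℤ → WangTile VColor HColor
  cell x y = tile (vcol _ _ (link y x)) (hcol (kind y) (proj₁ (inc y x)))
                  (hcol (kind (ℤ.suc y)) (proj₁ (inc (ℤ.suc y) x)))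
                  (vcol _ _ (link y (ℤ.suc x)))

  cell-tiling : IsTiling KariCulik cell
  cell-tiling = record
    { inT        = λ x y → cell-∈ _ _ (inc y x) (inc (ℤ.suc y) x) (link y x) (link y (ℤ.suc x))
    ; horizontal = λ _ _ → refl
    ; vertical   = λ _ _ → refl
    }

-- Floors and Beatty rows

i<suc[j]⇒i≤j : ∀ {i j} → i ℤ.< ℤ.suc j → i ℤ.≤ j
i<suc[j]⇒i≤j {j = j} i<sj = subst (_ ℤ.≤_) (ℤ.pred-suc j) (ℤ.i<j⇒i≤pred[j] i<sj)

pos⇒nonNeg : ∀ i .{{_ : ℤ.Positive i}} → ℤ.NonNegative i
pos⇒nonNeg i = ℤ.nonNegative (ℤ.<⇒≤ (ℤ.positive⁻¹ i))

near : ∀ {M u v} → u ℤ.≤ v → v ℤ.< u ℤ.+ + M → Near M u v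
near {M} {u} {v} u≤v v<u+M =
  fromℕ< k<M , trans v≡u+k (cong (λ n → u ℤ.+ + n) (sym (Fin.toℕ-fromℕ< k<M)))
  where
  k = ℤ.∣ v ℤ.- u ∣
  +k≡v-u : + k ≡ v ℤ.- u
  +k≡v-u = ℤ.0≤i⇒+∣i∣≡i (ℤ.i≤j⇒0≤j-i u≤v)
  v≡u+k : v ≡ u ℤ.+ + k
  v≡u+k = trans (lemma u v) (cong (λ t → u ℤ.+ t) (sym +k≡v-u))
    where
    lemma : ∀ u v → v ≡ u ℤ.+ (v ℤ.- u)
    lemma = ℤRing.solve-∀
  k<M : k ℕ.< M
  k<M = ℤ.drop‿+<+ (subst₂ ℤ._<_ (sym +k≡v-u) (lemma u (+ M)) (ℤ.+-monoˡ-< (ℤ.- u) v<u+M))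
    where
    lemma : ∀ u m → (u ℤ.+ m) ℤ.- u ≡ m
    lemma = ℤRing.solve-∀

record IsFloor (z : ℤ) (q : ℕ) (a : ℤ) : Set where
  constructor floor
  field
    below : a ℤ.* + q ℤ.≤ z
    above : z ℤ.< ℤ.suc a ℤ.* + q

open IsFloor

/ℕ-floor : ∀ z q .{{_ : NonZero q}} → IsFloor z q (z ℤ./ℕ q)
/ℕ-floor z q = floor (ℤ.[n/ℕd]*d≤n z q) (begin-strict
  z                                     ≡⟨ ℤ.a≡a%ℕn+[a/ℕn]*n z q ⟩
  + (z ℤ.%ℕ q) ℤ.+ (z ℤ./ℕ q) ℤ.* + q   <⟨ ℤ.+-monoˡ-< ((z ℤ./ℕ q) ℤ.* + q) (ℤ.+<+ (ℤ.n%ℕd<d z q)) ⟩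
  + q ℤ.+ (z ℤ./ℕ q) ℤ.* + q            ≡⟨ ℤ.suc-* (z ℤ./ℕ q) (+ q) ⟨
  ℤ.suc (z ℤ./ℕ q) ℤ.* + q              ∎)
  where open ℤ.≤-Reasoning

module _ {z d a b} {q} .{{_ : NonZero q}}
         (fa : IsFloor z q a) (fb : IsFloor (z ℤ.+ d) q b) where

  open ℤ.≤-Reasoning

  floor-grow-≥ : ∀ k → + k ℤ.* + q ℤ.≤ d → + k ℤ.+ a ℤ.≤ b
  floor-grow-≥ k kq≤d = i<suc[j]⇒i≤j (ℤ.*-cancelʳ-<-nonNeg (+ q) (begin-strict
    (+ k ℤ.+ a) ℤ.* + q           ≡⟨ ℤ.*-distribʳ-+ (+ q) (+ k) a ⟩
    + k ℤ.* + q ℤ.+ a ℤ.* + q     ≤⟨ ℤ.+-mono-≤ kq≤d (below fa) ⟩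
    d ℤ.+ z                       ≡⟨ ℤ.+-comm d z ⟩
    z ℤ.+ d                       <⟨ above fb ⟩
    ℤ.suc b ℤ.* + q               ∎))

  floor-grow-≤ : ∀ k → d ℤ.≤ + k ℤ.* + q → b ℤ.≤ + k ℤ.+ a
  floor-grow-≤ k d≤kq = i<suc[j]⇒i≤j (ℤ.*-cancelʳ-<-nonNeg (+ q) (begin-strict
    b ℤ.* + q                             ≤⟨ below fb ⟩
    z ℤ.+ d                               <⟨ ℤ.+-mono-<-≤ (above fa) d≤kq ⟩
    ℤ.suc a ℤ.* + q ℤ.+ + k ℤ.* + q       ≡⟨ lemma a (+ k) (+ q) ⟩
    ℤ.suc (+ k ℤ.+ a) ℤ.* + q             ∎))
    where
    lemma : ∀ a k q → (+ 1 ℤ.+ a) ℤ.* q ℤ.+ k ℤ.* q ≡ (+ 1 ℤ.+ (k ℤ.+ a)) ℤ.* q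
    lemma = ℤRing.solve-∀

  floor-inc : ∀ k → + k ℤ.* + q ℤ.≤ d → d ℤ.≤ + (suc k) ℤ.* + q → Near 2 (+ k ℤ.+ a) b
  floor-inc k lo hi = near (floor-grow-≥ k lo)
    (ℤ.≤-<-trans (floor-grow-≤ (suc k) hi) (begin-strict
      + suc k ℤ.+ a                 <⟨ ℤ.suc[i]≤j⇒i<j ℤ.≤-refl ⟩
      ℤ.suc (+ suc k ℤ.+ a)         ≡⟨ lemma (+ k) a ⟩
      + k ℤ.+ a ℤ.+ + 2             ∎))
    where
    lemma : ∀ k a → + 1 ℤ.+ ((+ 1 ℤ.+ k) ℤ.+ a) ≡ k ℤ.+ a ℤ.+ + 2
    lemma = ℤRing.solve-∀

-- The hypothesis says p′/q′ = M p/q, and the floor of M t lies between M times the floor of t and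
-- less than M above it. Everything is compared after multiplication by q q′, where `middle` is the
-- common value.
floor-scale : ∀ M x {p q p′ q′ a a′} .{{_ : NonZero M}} .{{_ : NonZero q}} .{{_ : NonZero q′}} →
              p′ ℕ.* q ≡ M ℕ.* (p ℕ.* q′) →
              IsFloor (x ℤ.* + p) q a → IsFloor (x ℤ.* + p′) q′ a′ →
              Near M (+ M ℤ.* a) a′
floor-scale M x {p} {q} {p′} {q′} {a} {a′} eq fa fa′ = near lo hi
  where
  open ℤ.≤-Reasoning
  P = + p ; Q = + q ; P′ = + p′ ; Q′ = + q′ ; M′ = + M
  QQ′ = Q ℤ.* Q′
  instance
    M>0 : ℤ.Positive M′
    M>0 = ℤ.positive (ℤ.+<+ (ℕ.>-nonZero⁻¹ M))
    Q>0 : ℤ.Positive Q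
    Q>0 = ℤ.positive (ℤ.+<+ (ℕ.>-nonZero⁻¹ q))
    Q′>0 : ℤ.Positive Q′
    Q′>0 = ℤ.positive (ℤ.+<+ (ℕ.>-nonZero⁻¹ q′))
    MQ′>0 : ℤ.Positive (M′ ℤ.* Q′)
    MQ′>0 = ℤ.positive (subst (+ 0 ℤ.<_) (ℤ.pos-* M q′)
              (ℤ.+<+ (ℕ.>-nonZero⁻¹ (M ℕ.* q′) {{ℕ.m*n≢0 M q′}})))
    QQ′>0 : ℤ.Positive QQ′
    QQ′>0 = ℤ.positive (subst (+ 0 ℤ.<_) (ℤ.pos-* q q′)
              (ℤ.+<+ (ℕ.>-nonZero⁻¹ (q ℕ.* q′) {{ℕ.m*n≢0 q q′}})))
  middle : (x ℤ.* P) ℤ.* (M′ ℤ.* Q′) ≡ (x ℤ.* P′) ℤ.* Q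
  middle = begin-equality
    (x ℤ.* P) ℤ.* (M′ ℤ.* Q′)  ≡⟨ regroup x P M′ Q′ ⟩
    x ℤ.* (M′ ℤ.* (P ℤ.* Q′))  ≡⟨ cong (λ t → x ℤ.* t) cross ⟨
    x ℤ.* (P′ ℤ.* Q)           ≡⟨ ℤ.*-assoc x P′ Q ⟨
    (x ℤ.* P′) ℤ.* Q           ∎
    where
    regroup : ∀ x p m q → (x ℤ.* p) ℤ.* (m ℤ.* q) ≡ x ℤ.* (m ℤ.* (p ℤ.* q))
    regroup = ℤRing.solve-∀
    cross : P′ ℤ.* Q ≡ M′ ℤ.* (P ℤ.* Q′)
    cross = trans (sym (ℤ.pos-* p′ q)) (trans (cong +_ eq)
              (trans (ℤ.pos-* M _) (cong (λ t → M′ ℤ.* t) (ℤ.pos-* p q′))))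
  re₁ : ∀ m a q q′ → (m ℤ.* a) ℤ.* (q ℤ.* q′) ≡ (a ℤ.* q) ℤ.* (m ℤ.* q′)
  re₁ = ℤRing.solve-∀
  re₂ : ∀ a q q′ → (a ℤ.* q′) ℤ.* q ≡ a ℤ.* (q ℤ.* q′)
  re₂ = ℤRing.solve-∀
  re₃ : ∀ m a q q′ → ((+ 1 ℤ.+ a) ℤ.* q) ℤ.* (m ℤ.* q′) ≡ (m ℤ.* a ℤ.+ m) ℤ.* (q ℤ.* q′)
  re₃ = ℤRing.solve-∀
  lo : M′ ℤ.* a ℤ.≤ a′
  lo = i<suc[j]⇒i≤j (ℤ.*-cancelʳ-<-nonNeg QQ′ {{pos⇒nonNeg QQ′}} (begin-strict
    (M′ ℤ.* a) ℤ.* QQ′            ≡⟨ re₁ M′ a Q Q′ ⟩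
    (a ℤ.* Q) ℤ.* (M′ ℤ.* Q′)     ≤⟨ ℤ.*-monoʳ-≤-nonNeg (M′ ℤ.* Q′) {{pos⇒nonNeg (M′ ℤ.* Q′)}} (below fa) ⟩
    (x ℤ.* P) ℤ.* (M′ ℤ.* Q′)     ≡⟨ middle ⟩
    (x ℤ.* P′) ℤ.* Q              <⟨ ℤ.*-monoʳ-<-pos Q (above fa′) ⟩
    (ℤ.suc a′ ℤ.* Q′) ℤ.* Q       ≡⟨ re₂ (ℤ.suc a′) Q Q′ ⟩
    ℤ.suc a′ ℤ.* QQ′              ∎))
  hi : a′ ℤ.< M′ ℤ.* a ℤ.+ M′
  hi = ℤ.*-cancelʳ-<-nonNeg QQ′ {{pos⇒nonNeg QQ′}} (begin-strict
    a′ ℤ.* QQ′                       ≡⟨ re₂ a′ Q Q′ ⟨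
    (a′ ℤ.* Q′) ℤ.* Q                ≤⟨ ℤ.*-monoʳ-≤-nonNeg Q (below fa′) ⟩
    (x ℤ.* P′) ℤ.* Q                 ≡⟨ middle ⟨
    (x ℤ.* P) ℤ.* (M′ ℤ.* Q′)        <⟨ ℤ.*-monoʳ-<-pos (M′ ℤ.* Q′) (above fa) ⟩
    (ℤ.suc a ℤ.* Q) ℤ.* (M′ ℤ.* Q′)  ≡⟨ re₃ M′ a Q Q′ ⟩
    (M′ ℤ.* a ℤ.+ M′) ℤ.* QQ′        ∎)

-- Rational slopes and the slope map on rows

infix 4 _·_≼_·_ _·_≺_·_

-- Records rather than abbreviations, so that unification recovers the four arguments.
record _·_≼_·_ (a q b p : ℕ) : Set where
  constructor ≼⁺
  field ≼⁻ : a ℕ.* q ℕ.≤ b ℕ.* p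

record _·_≺_·_ (a p b q : ℕ) : Set where
  constructor ≺⁺
  field ≺⁻ : a ℕ.* p ℕ.< b ℕ.* q

≺-total : ∀ a p b q → a · p ≺ b · q ⊎ b · q ≼ a · p
≺-total a p b q with a ℕ.* p ℕ.<? b ℕ.* q
... | yes lt = inj₁ (≺⁺ lt)
... | no  ≮  = inj₂ (≼⁺ (ℕ.≮⇒≥ ≮))

-- The conclusion reads a c / (b d) ≤ p/q. Given a₀/b₀ ≤ p/q, only numerals remain to be compared,
-- and for literals the implicit `w` is found by evaluation.
ratio-≤ : ∀ a c b d {a₀ b₀ p q} .{{_ : NonZero b₀}} → a₀ · q ≼ b₀ · p →
          {True ((a ℕ.* c) ℕ.* b₀ ℕ.≤? a₀ ℕ.* (b ℕ.* d))} →
          a · c ℕ.* q ≼ b · d ℕ.* p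
ratio-≤ a c b d {a₀} {b₀} {p} {q} (≼⁺ h) {w} = ≼⁺ (ℕ.*-cancelˡ-≤ b₀ (begin
  b₀ ℕ.* (a ℕ.* (c ℕ.* q))      ≡⟨ lhs b₀ a c q ⟩
  ((a ℕ.* c) ℕ.* b₀) ℕ.* q      ≤⟨ ℕ.*-monoˡ-≤ q (toWitness w) ⟩
  (a₀ ℕ.* (b ℕ.* d)) ℕ.* q      ≡⟨ swap a₀ b d q ⟩
  (b ℕ.* d) ℕ.* (a₀ ℕ.* q)      ≤⟨ ℕ.*-monoʳ-≤ (b ℕ.* d) h ⟩
  (b ℕ.* d) ℕ.* (b₀ ℕ.* p)      ≡⟨ rhs b₀ b d p ⟩
  b₀ ℕ.* (b ℕ.* (d ℕ.* p))      ∎))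
  where
  open ℕ.≤-Reasoning
  lhs : ∀ b₀ a c q → b₀ ℕ.* (a ℕ.* (c ℕ.* q)) ≡ ((a ℕ.* c) ℕ.* b₀) ℕ.* q
  lhs = ℕRing.solve-∀
  swap : ∀ a₀ b d q → (a₀ ℕ.* (b ℕ.* d)) ℕ.* q ≡ (b ℕ.* d) ℕ.* (a₀ ℕ.* q)
  swap = ℕRing.solve-∀
  rhs : ∀ b₀ b d p → (b ℕ.* d) ℕ.* (b₀ ℕ.* p) ≡ b₀ ℕ.* (b ℕ.* (d ℕ.* p))
  rhs = ℕRing.solve-∀

ratio-< : ∀ a c b d {a₀ b₀ p q} .{{_ : NonZero a₀}} .{{_ : NonZero (a ℕ.* c)}} →
          a₀ · p ≺ b₀ · q →
          {True ((a ℕ.* c) ℕ.* b₀ ℕ.≤? a₀ ℕ.* (b ℕ.* d))} →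
          a · c ℕ.* p ≺ b · d ℕ.* q
ratio-< a c b d {a₀} {b₀} {p} {q} (≺⁺ h) {w} = ≺⁺ (ℕ.*-cancelˡ-< a₀ _ _ (begin-strict
  a₀ ℕ.* (a ℕ.* (c ℕ.* p))      ≡⟨ lhs a₀ a c p ⟩
  (a ℕ.* c) ℕ.* (a₀ ℕ.* p)      <⟨ ℕ.*-monoʳ-< (a ℕ.* c) h ⟩
  (a ℕ.* c) ℕ.* (b₀ ℕ.* q)      ≡⟨ ℕ.*-assoc (a ℕ.* c) b₀ q ⟨
  ((a ℕ.* c) ℕ.* b₀) ℕ.* q      ≤⟨ ℕ.*-monoˡ-≤ q (toWitness w) ⟩
  (a₀ ℕ.* (b ℕ.* d)) ℕ.* q      ≡⟨ rhs a₀ b d q ⟩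
  a₀ ℕ.* (b ℕ.* (d ℕ.* q))      ∎))
  where
  open ℕ.≤-Reasoning
  lhs : ∀ a₀ a c p → a₀ ℕ.* (a ℕ.* (c ℕ.* p)) ≡ (a ℕ.* c) ℕ.* (a₀ ℕ.* p)
  lhs = ℕRing.solve-∀
  rhs : ∀ a₀ b d q → (a₀ ℕ.* (b ℕ.* d)) ℕ.* q ≡ a₀ ℕ.* (b ℕ.* (d ℕ.* q))
  rhs = ℕRing.solve-∀

Bounds : Kind → ℕ → ℕ → Set
Bounds A p q = 1 · q ≼ 3 · p × 3 · p ≺ 2 · q
Bounds B p q = 2 · q ≼ 3 · p × 1 · p ≺ 1 · q
Bounds C p q = 1 · q ≼ 1 · p × 1 · p ≺ 2 · q

record Row : Set where
  constructor row
  field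
    kind   : Kind
    num    : ℕ
    den    : ℕ
    bounds : Bounds kind num den

  -- A zero denominator contradicts the strict upper bound of every kind.
  den≢0 : NonZero den
  den≢0 = go kind den bounds
    where
    go : ∀ k q → Bounds k num q → NonZero q
    go k (suc _) _        = _
    go A zero    (_ , ≺⁺ ())
    go B zero    (_ , ≺⁺ ())
    go C zero    (_ , ≺⁺ ())

  private instance _ = den≢0

  height : ℤ → ℤ
  height x = (x ℤ.* + num) ℤ./ℕ den

  height-floor : ∀ x → IsFloor (x ℤ.* + num) den (height x)
  height-floor x = /ℕ-floor (x ℤ.* + num) den

open Row

height-inc : ∀ r x → Inc (kind r) (height r x) (height r (ℤ.suc x))
height-inc r@(row k p q b) x = floor-inc {d = + p} (height-floor r x) next (base k) (lo k b) (hi k b)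
  where
  instance _ = den≢0 r
  next : IsFloor (x ℤ.* + p ℤ.+ + p) q (height r (ℤ.suc x))
  next = subst (λ z → IsFloor z q (height r (ℤ.suc x)))
    (trans (ℤ.suc-* x (+ p)) (ℤ.+-comm (+ p) (x ℤ.* + p))) (height-floor r (ℤ.suc x))
  lo : ∀ k → Bounds k p q → + base k ℤ.* + q ℤ.≤ + p
  lo A _ = ℤ.+≤+ ℕ.z≤n
  lo B _ = ℤ.+≤+ ℕ.z≤n
  lo C (≼⁺ q≤p , _) = subst₂ ℤ._≤_ (ℤ.pos-* 1 q) (cong +_ (ℕ.*-identityˡ p)) (ℤ.+≤+ q≤p)
  slope< : ∀ k → Bounds k p q → 1 · p ≺ suc (base k) · q
  slope< A (_ , h) = subst₂ (1 ·_≺ 1 ·_) (ℕ.*-identityˡ p) (ℕ.*-identityˡ q) (ratio-< 1 1 1 1 h)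
  slope< B (_ , h) = h
  slope< C (_ , h) = h
  hi : ∀ k → Bounds k p q → + p ℤ.≤ + suc (base k) ℤ.* + q
  hi k b = let ≺⁺ h = slope< k b in
    subst₂ ℤ._≤_ (cong +_ (ℕ.*-identityˡ p)) (ℤ.pos-* (suc (base k)) q) (ℤ.+≤+ (ℕ.<⇒≤ h))

infix 4 _↝_

_↝_ : Row → Row → Set
r ↝ r′ = ∀ x → Link (kind r) (kind r′) (height r x) (height r′ x)

module _ (r r′ : Row) where
  private
    instance
      _ = den≢0 r
      _ = den≢0 r′

  doubles : num r′ ℕ.* den r ≡ 2 ℕ.* (num r ℕ.* den r′) →
            ∀ x → Near 2 (+ 2 ℤ.* height r x) (height r′ x)
  doubles eq x = floor-scale 2 x {num r} {den r} {num r′} {den r′} eq (height-floor r x) (height-floor r′ x)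

  thirds : num r ℕ.* den r′ ≡ 3 ℕ.* (num r′ ℕ.* den r) →
           ∀ x → Near 3 (+ 3 ℤ.* height r′ x) (height r x)
  thirds eq x = floor-scale 3 x {num r′} {den r′} {num r} {den r} eq (height-floor r′ x) (height-floor r x)

×2-num : ∀ p q → (2 ℕ.* p) ℕ.* q ≡ 2 ℕ.* (p ℕ.* (1 ℕ.* q))
×2-num = ℕRing.solve-∀
×2-den : ∀ p q → p ℕ.* (2 ℕ.* q) ≡ 2 ℕ.* ((1 ℕ.* p) ℕ.* q)
×2-den = ℕRing.solve-∀
×3-num : ∀ p q → (3 ℕ.* p) ℕ.* q ≡ 3 ℕ.* (p ℕ.* (1 ℕ.* q))
×3-num = ℕRing.solve-∀
×3-den : ∀ p q → p ℕ.* (3 ℕ.* q) ≡ 3 ℕ.* ((1 ℕ.* p) ℕ.* q)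
×3-den = ℕRing.solve-∀

-- The factors `1 ℕ.*` keep slopes in the form in which `ratio-≤` and `ratio-<` conclude.
AB : ∀ p q → Bounds A p q → 2 · p ≺ 1 · q → Row
AB p q (lo , _) 2p<q = row B (2 ℕ.* p) (1 ℕ.* q) (ratio-≤ 2 1 3 2 lo , ratio-< 1 2 1 1 2p<q)

AC : ∀ p q → Bounds A p q → 1 · q ≼ 2 · p → Row
AC p q (_ , hi) q≤2p = row C (2 ℕ.* p) (1 ℕ.* q) (ratio-≤ 1 1 1 2 q≤2p , ratio-< 1 2 2 1 hi)

BC : ∀ p q → Bounds B p q → Row
BC p q (lo , hi) = row C (2 ℕ.* p) (1 ℕ.* q) (ratio-≤ 1 1 1 2 lo , ratio-< 1 2 2 1 hi)

CA : ∀ p q → Bounds C p q → Row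
CA p q (lo , hi) = row A (1 ℕ.* p) (3 ℕ.* q) (ratio-≤ 1 3 3 1 lo , ratio-< 3 1 2 3 hi)

-- The comparison is an argument, so that later lemmas can split on an arbitrary outcome and refute
-- the impossible one.
upA : ∀ p q → Bounds A p q → 2 · p ≺ 1 · q ⊎ 1 · q ≼ 2 · p → Row
upA p q b (inj₁ 2p<q) = AB p q b 2p<q
upA p q b (inj₂ q≤2p) = AC p q b q≤2p

up : Row → Row
up (row A p q b) = upA p q b (≺-total 2 p 1 q)
up (row B p q b) = BC p q b
up (row C p q b) = CA p q b

up-↝ : ∀ r → r ↝ up r
up-↝ r@(row A p q b) with ≺-total 2 p 1 q
... | inj₁ 2p<q = doubles r (AB p q b 2p<q) (×2-num p q)
... | inj₂ q≤2p = doubles r (AC p q b q≤2p) (×2-num p q)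
up-↝ r@(row B p q b) = doubles r (up r) (×2-num p q)
up-↝ r@(row C p q b) = thirds r (up r) (×3-den p q)

tripled : ∀ p q → Bounds A p q → Row
tripled p q (lo , hi) = row C (3 ℕ.* p) (1 ℕ.* q) (ratio-≤ 1 1 1 3 lo , ratio-< 1 3 2 1 hi)

halvedA : ∀ p q → 1 · 2 ℕ.* q ≼ 3 · 1 ℕ.* p → 3 · 1 ℕ.* p ≺ 2 · 2 ℕ.* q → Row
halvedA p q lo hi = row A (1 ℕ.* p) (2 ℕ.* q) (lo , hi)

halvedB : ∀ p q → 4 · q ≼ 3 · p → 1 · p ≺ 2 · q → Row
halvedB p q lo hi = row B (1 ℕ.* p) (2 ℕ.* q) (ratio-≤ 2 2 3 1 lo , ratio-< 1 1 1 2 hi)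

downC : ∀ p q → Bounds C p q → 3 · p ≺ 4 · q ⊎ 4 · q ≼ 3 · p → Row
downC p q (lo , _) (inj₁ 3p<4q) = halvedA p q (ratio-≤ 1 2 3 1 lo) (ratio-< 3 1 2 2 3p<4q)
downC p q (_ , hi) (inj₂ 4q≤3p) = halvedB p q 4q≤3p hi

-- The slope map is a bijection of [1/3,2): slopes below 2/3 are thirds of slopes in [1,2), the
-- others are doubles of slopes in [1/3,1). So there is always a predecessor. Halving a C row gives
-- kind A exactly when its slope is below 4/3.
down : Row → Row
down (row A p q b)         = tripled p q b
down (row B p q (lo , hi)) = halvedA p q (ratio-≤ 1 2 3 1 lo) (ratio-< 3 1 2 2 hi)
down (row C p q b)         = downC p q b (≺-total 3 p 4 q)

down-↝ : ∀ r → down r ↝ r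
down-↝ r@(row A p q b) = thirds (tripled p q b) r (×3-num p q)
down-↝ r@(row B p q b) = doubles (down r) r (×2-den p q)
down-↝ r@(row C p q (lo , hi)) with ≺-total 3 p 4 q
... | inj₁ 3p<4q = doubles (halvedA p q (ratio-≤ 1 2 3 1 lo) (ratio-< 3 1 2 2 3p<4q)) r (×2-den p q)
... | inj₂ 4q≤3p = doubles (halvedB p q 4q≤3p hi) r (×2-den p q)

ups downs : ℕ → Row → Row
ups zero      r = r
ups (suc n)   r = up (ups n r)
downs zero    r = r
downs (suc n) r = down (downs n r)

module Orbit (r : Row) where

  orbit : ℤ → Row
  orbit (+ n)      = ups n r
  orbit (-[1+ n ]) = downs (suc n) r

  orbit-↝ : ∀ y → orbit y ↝ orbit (ℤ.suc y)
  orbit-↝ (+ n)          = up-↝ (ups n r)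
  orbit-↝ -[1+ zero ]    = down-↝ r
  orbit-↝ -[1+ suc n ]   = down-↝ (downs (suc n) r)

  beatty : Height (λ y → kind (orbit y))
  beatty = record
    { val  = λ y → height (orbit y)
    ; inc  = λ y → height-inc (orbit y)
    ; link = orbit-↝
    }

-- Recurrence of the slopes in [3/2,16/9]

data Good : Row → Set where
  good : ∀ {p q b} → 3 · q ≼ 2 · p → 9 · p ≼ 16 · q → Good (row C p q b)

Soon : ℕ → Row → Set
Soon n r = ∃[ k ] k ℕ.≤ n × Good (ups k r)

soon-up : ∀ {n r} → Soon n (up r) → Soon (suc n) r
soon-up {r = r} (k , k≤n , g) = suc k , ℕ.s≤s k≤n , subst Good (ups-up k) g
  where
  ups-up : ∀ k → ups k (up r) ≡ up (ups k r)
  ups-up zero    = refl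
  ups-up (suc k) = cong up (ups-up k)

soon-mono : ∀ {m n r} → m ℕ.≤ n → Soon m r → Soon n r
soon-mono m≤n (k , k≤m , g) = k , ℕ.≤-trans k≤m m≤n , g

SoonC : ℕ → ℕ → ℕ → Set
SoonC n p q = ∀ {b} → Soon n (row C p q b)

≺⇒≼ : ∀ {a p b q} → a · p ≺ b · q → a · p ≼ b · q
≺⇒≼ (≺⁺ h) = ≼⁺ (ℕ.<⇒≤ h)

≺⇒⋡ : ∀ {X : Set} {a p b q} → a · p ≺ b · q → b · q ≼ a · p → X
≺⇒⋡ (≺⁺ h) (≼⁺ h′) = contradiction h′ (ℕ.<⇒≱ h)

after-AB : ∀ {n p q b} s → 2 · p ≺ 1 · q → SoonC n (2 ℕ.* (2 ℕ.* p)) (1 ℕ.* (1 ℕ.* q)) →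
           Soon (suc n) (upA p q b s)
after-AB (inj₁ _)    _    h = soon-up h
after-AB (inj₂ q≤2p) 2p<q _ = ≺⇒⋡ 2p<q q≤2p

after-AC : ∀ {n p q b} s → 1 · q ≼ 2 · p → SoonC n (2 ℕ.* p) (1 ℕ.* q) →
           Soon n (upA p q b s)
after-AC (inj₁ 2p<q) q≤2p _ = ≺⇒⋡ 2p<q q≤2p
after-AC (inj₂ _)    _    h = h

-- With `soon-CAC` this is the return map to C rows: y/3 has to be doubled twice if y < 3/2 and once
-- otherwise, so y goes to 4y/3 after three rows or to 2y/3 after two.
soon-CABC : ∀ {n p q} → 2 · p ≺ 3 · q → SoonC n (4 ℕ.* p) (3 ℕ.* q) → SoonC (3 ℕ.+ n) p q
soon-CABC {n} {p} {q} h s = soon-up (soon-up (after-AB (≺-total 2 (1 ℕ.* p) 1 (3 ℕ.* q)) (ratio-< 2 1 1 3 h)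
  (subst₂ (λ p q → SoonC n p q) (num≡ p) (den≡ q) s)))
  where
  num≡ : ∀ p → 4 ℕ.* p ≡ 2 ℕ.* (2 ℕ.* (1 ℕ.* p))
  num≡ = ℕRing.solve-∀
  den≡ : ∀ q → 3 ℕ.* q ≡ 1 ℕ.* (1 ℕ.* (3 ℕ.* q))
  den≡ = ℕRing.solve-∀

soon-CAC : ∀ {n p q} → 3 · q ≼ 2 · p → SoonC n (2 ℕ.* p) (3 ℕ.* q) → SoonC (2 ℕ.+ n) p q
soon-CAC {n} {p} {q} h s = soon-up (soon-up (after-AC (≺-total 2 (1 ℕ.* p) 1 (3 ℕ.* q)) (ratio-≤ 1 3 2 1 h)
  (subst₂ (λ p q → SoonC n p q) (num≡ p) (den≡ q) s)))
  where
  num≡ : ∀ p → 2 ℕ.* p ≡ 2 ℕ.* (1 ℕ.* p)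
  num≡ = ℕRing.solve-∀
  den≡ : ∀ q → 3 ℕ.* q ≡ 1 ℕ.* (3 ℕ.* q)
  den≡ = ℕRing.solve-∀

relax-≤ : ∀ a b {a₀ b₀ p q} .{{_ : NonZero b₀}} → a₀ · q ≼ b₀ · p →
          {True ((a ℕ.* 1) ℕ.* b₀ ℕ.≤? a₀ ℕ.* (b ℕ.* 1))} → a · q ≼ b · p
relax-≤ a b {p = p} {q} h {w} =
  subst₂ (a ·_≼ b ·_) (ℕ.*-identityˡ q) (ℕ.*-identityˡ p) (ratio-≤ a 1 b 1 h {w})

relax-< : ∀ a b {a₀ b₀ p q} .{{_ : NonZero a₀}} .{{_ : NonZero (a ℕ.* 1)}} → a₀ · p ≺ b₀ · q →
          {True ((a ℕ.* 1) ℕ.* b₀ ℕ.≤? a₀ ℕ.* (b ℕ.* 1))} → a · p ≺ b · q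
relax-< a b {p = p} {q} h {w} =
  subst₂ (a ·_≺ b ·_) (ℕ.*-identityˡ p) (ℕ.*-identityˡ q) (ratio-< a 1 b 1 h {w})

soon-good : ∀ {p q} → 3 · q ≼ 2 · p → 9 · p ≼ 16 · q → SoonC 0 p q
soon-good lo hi = 0 , ℕ.z≤n , good lo hi

-- The slope y = p/q of a C row runs through [1,4/3) → [4/3,3/2) → [16/9,2) → [32/27,4/3) and
-- then reaches [3/2,16/9], unless it is there earlier.

-- The image under y ↦ 4y/3 is [128/81,16/9), and 128/81 exceeds 3/2.
soon-32/27 : ∀ {p q} → 32 · q ≼ 27 · p → 3 · p ≺ 4 · q → SoonC 3 p q
soon-32/27 lo hi = soon-CABC (relax-< 2 3 hi) (soon-good (ratio-≤ 3 3 2 4 lo) (≺⇒≼ (ratio-< 9 4 16 3 hi)))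

soon-16/9 : ∀ {p q} → 16 · q ≼ 9 · p → 1 · p ≺ 2 · q → SoonC 5 p q
soon-16/9 lo hi = soon-CAC (relax-≤ 3 2 lo) (soon-32/27 (ratio-≤ 32 3 27 2 lo) (ratio-< 3 2 4 3 hi))

soon-4/3 : ∀ {p q} → 4 · q ≼ 3 · p → 2 · p ≺ 3 · q → SoonC 8 p q
soon-4/3 lo hi = soon-CABC hi (soon-16/9 (ratio-≤ 16 3 9 4 lo) (ratio-< 1 4 2 3 hi))

soon-1 : ∀ {p q} → 1 · q ≼ 1 · p → 3 · p ≺ 4 · q → SoonC 11 p q
soon-1 {p} {q} lo hi = soon-CABC (relax-< 2 3 hi) next
  where
  next : SoonC 8 (4 ℕ.* p) (3 ℕ.* q)
  next with ≺-total 2 (4 ℕ.* p) 3 (3 ℕ.* q)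
  ... | inj₁ y<3/2 = soon-4/3 (ratio-≤ 4 3 3 4 lo) y<3/2
  ... | inj₂ 3/2≤y = soon-mono ℕ.z≤n (soon-good 3/2≤y (≺⇒≼ (ratio-< 9 4 16 3 hi)))

soon-C : ∀ {p q} → SoonC 11 p q
soon-C {p} {q} {lo , hi} with ≺-total 3 p 4 q
... | inj₁ y<4/3 = soon-1 lo y<4/3
... | inj₂ 4/3≤y with ≺-total 2 p 3 q
...   | inj₁ y<3/2 = soon-mono (ℕ.m≤m+n 8 3) (soon-4/3 4/3≤y y<3/2)
...   | inj₂ 3/2≤y with ≺-total 9 p 16 q
...     | inj₁ y<16/9 = soon-mono ℕ.z≤n (soon-good 3/2≤y (≺⇒≼ y<16/9))
...     | inj₂ 16/9≤y = soon-mono (ℕ.m≤m+n 5 6) (soon-16/9 16/9≤y hi)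

-- At most two rows, of kinds A and B, precede the first C row, whence 13 = 11 + 2.
soon : ∀ r → Soon 13 r
soon (row C p q b) = soon-mono (ℕ.m≤m+n 11 2) soon-C
soon (row B p q b) = soon-up (soon-mono (ℕ.m≤m+n 11 1) soon-C)
soon (row A p q b) = soon-up (after-A (≺-total 2 p 1 q))
  where
  after-A : ∀ s → Soon 12 (upA p q b s)
  after-A (inj₁ _) = soon-up soon-C
  after-A (inj₂ _) = soon-mono (ℕ.m≤m+n 11 1) soon-C

-- Exchangeable heights

sucℤ-injective : ∀ {x y} → ℤ.suc x ≡ ℤ.suc y → x ≡ y
sucℤ-injective {x} {y} eq = trans (sym (ℤ.pred-suc x)) (trans (cong ℤ.pred eq) (ℤ.pred-suc y))

near-unique : ∀ {M a b v} .{{_ : NonZero M}} → Near M (+ M ℤ.* a) v → Near M (+ M ℤ.* b) v → a ≡ b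
near-unique {M} {v = v} na nb = ℤ.≤-antisym (go na nb) (go nb na)
  where
  open ℤ.≤-Reasoning
  instance
    M>0 : ℤ.Positive (+ M)
    M>0 = ℤ.positive (ℤ.+<+ (ℕ.>-nonZero⁻¹ M))
  M*suc : ∀ m b → m ℤ.* b ℤ.+ m ≡ m ℤ.* (+ 1 ℤ.+ b)
  M*suc = ℤRing.solve-∀
  go : ∀ {a b} → Near M (+ M ℤ.* a) v → Near M (+ M ℤ.* b) v → a ℤ.≤ b
  go {a} {b} (e , v≡) (e′ , v≡′) = i<suc[j]⇒i≤j (ℤ.*-cancelˡ-<-nonNeg (+ M) (begin-strict
    + M ℤ.* a                  ≤⟨ ℤ.i≤i+j (+ M ℤ.* a) (+ toℕ e) ⟩
    + M ℤ.* a ℤ.+ + toℕ e      ≡⟨ v≡ ⟨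
    v                          ≡⟨ v≡′ ⟩
    + M ℤ.* b ℤ.+ + toℕ e′     <⟨ ℤ.+-monoʳ-< (+ M ℤ.* b) (ℤ.+<+ (Fin.toℕ<n e′)) ⟩
    + M ℤ.* b ℤ.+ + M          ≡⟨ M*suc (+ M) b ⟩
    + M ℤ.* ℤ.suc b            ∎))

near-exists : ∀ M v .{{_ : NonZero M}} → ∃[ a ] Near M (+ M ℤ.* a) v
near-exists M v = v ℤ./ℕ M , fromℕ< r<M , (begin
  v                                           ≡⟨ ℤ.a≡a%ℕn+[a/ℕn]*n v M ⟩
  + (v ℤ.%ℕ M) ℤ.+ (v ℤ./ℕ M) ℤ.* + M         ≡⟨ lemma (+ (v ℤ.%ℕ M)) (v ℤ./ℕ M) (+ M) ⟩
  + M ℤ.* (v ℤ./ℕ M) ℤ.+ + (v ℤ.%ℕ M)         ≡⟨ cong (λ n → + M ℤ.* (v ℤ./ℕ M) ℤ.+ + n) (Fin.toℕ-fromℕ< r<M) ⟨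
  + M ℤ.* (v ℤ./ℕ M) ℤ.+ + toℕ (fromℕ< r<M)   ∎)
  where
  open ≡-Reasoning
  r<M = ℤ.n%ℕd<d v M
  lemma : ∀ r a m → r ℤ.+ a ℤ.* m ≡ m ℤ.* a ℤ.+ r
  lemma = ℤRing.solve-∀

SameQuotient : ℕ → ℤ → ℤ → Set
SameQuotient M v w = ∃[ c ] Near M (+ M ℤ.* c) v × Near M (+ M ℤ.* c) w

same-quotient : ∀ {M v w a} .{{_ : NonZero M}} → SameQuotient M v w → Near M (+ M ℤ.* a) v → Near M (+ M ℤ.* a) w
same-quotient {M} {w = w} (c , nv , nw) n = subst (λ a → Near M (+ M ℤ.* a) w) (near-unique nv n) nw

-- `half` protects the link from the row below, which was doubled into this row, and `third` the
-- link to the row above. `left` names the previous column by its successor, which avoids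
-- subtraction.
record Swap (g : ℤ → ℤ) (x : ℤ) : Set where
  field
    value   : ℤ
    changed : value ≢ g x
    half    : SameQuotient 2 (g x) value
    third   : SameQuotient 3 (g x) value
    left    : ∀ x′ → ℤ.suc x′ ≡ x → Inc C (g x′) value
    right   : Inc C value (g (ℤ.suc x))

module _ (g : ℤ → ℤ) (inc : ∀ x → Inc C (g x) (g (ℤ.suc x))) where

  OddUnitStep : ℤ → Set
  OddUnitStep x = (∃[ c ] g x ≡ + 2 ℤ.* c ℤ.+ + 1) × g (ℤ.suc x) ≡ + 1 ℤ.+ g x

  Found : ℕ → ℤ → Set
  Found k x = ∃[ n ] n ℕ.< k × OddUnitStep (+ n ℤ.+ x)

  later : ∀ n x → + n ℤ.+ ℤ.suc x ≡ + suc n ℤ.+ x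
  later n x = lemma (+ n) x
    where
    lemma : ∀ n x → n ℤ.+ (+ 1 ℤ.+ x) ≡ (+ 1 ℤ.+ n) ℤ.+ x
    lemma = ℤRing.solve-∀

  found-suc : ∀ {k} x → Found k (ℤ.suc x) → Found (suc k) x
  found-suc x (n , n<k , h) = suc n , ℕ.s≤s n<k , subst OddUnitStep (later n x) h

  -- Steps of 2 keep the parity and a first unit step from an even height makes it odd, so at most
  -- one step is 1 before an odd unit step occurs.

  scan-odd : ∀ k x → (∃[ c ] g x ≡ + 2 ℤ.* c ℤ.+ + 1) →
             Found k x ⊎ g (+ k ℤ.+ x) ≡ + k ℤ.+ + k ℤ.+ g x
  scan-odd zero    x odd = inj₂ (lemma x)
    where
    lemma : ∀ x → g (+ 0 ℤ.+ x) ≡ + 0 ℤ.+ g x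
    lemma x = trans (cong g (ℤ.+-identityˡ x)) (sym (ℤ.+-identityˡ (g x)))
  scan-odd (suc k) x odd@(c , gx≡) with inc x
  ... | 0F , g≡ = inj₁ (0 , ℕ.s≤s ℕ.z≤n , subst OddUnitStep (sym (ℤ.+-identityˡ x))
                   (odd , trans g≡ (ℤ.+-identityʳ _)))
  ... | sucF 0F , g≡ with scan-odd k (ℤ.suc x) (ℤ.suc c , trans g≡ (trans (cong (λ t → + 1 ℤ.+ t ℤ.+ + 1) gx≡) (lemma c)))
    where
    lemma : ∀ c → + 1 ℤ.+ (+ 2 ℤ.* c ℤ.+ + 1) ℤ.+ + 1 ≡ + 2 ℤ.* (+ 1 ℤ.+ c) ℤ.+ + 1
    lemma = ℤRing.solve-∀
  ...   | inj₁ f  = inj₁ (found-suc x f)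
  ...   | inj₂ eq = inj₂ (trans (cong g (sym (later k x))) (trans eq (trans (cong (λ t → + k ℤ.+ + k ℤ.+ t) g≡) (lemma (+ k) (g x)))))
    where
    lemma : ∀ k v → k ℤ.+ k ℤ.+ (+ 1 ℤ.+ v ℤ.+ + 1) ≡ (+ 1 ℤ.+ k) ℤ.+ (+ 1 ℤ.+ k) ℤ.+ v
    lemma = ℤRing.solve-∀

  scan-even : ∀ k x → (∃[ c ] g x ≡ + 2 ℤ.* c) →
              Found k x ⊎ + k ℤ.+ + k ℤ.+ g x ℤ.≤ ℤ.suc (g (+ k ℤ.+ x))
  scan-even zero x even = inj₂ (subst₂ (λ u v → u ℤ.≤ ℤ.suc (g v))
    (sym (ℤ.+-identityˡ (g x))) (sym (ℤ.+-identityˡ x)) (ℤ.i≤suc[i] (g x)))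
  scan-even (suc k) x (c , gx≡) with inc x
  ... | 0F , g≡ with scan-odd k (ℤ.suc x) (c , trans g≡ (trans (cong (λ t → + 1 ℤ.+ t ℤ.+ + 0) gx≡) (lemma c)))
    where
    lemma : ∀ c → + 1 ℤ.+ (+ 2 ℤ.* c) ℤ.+ + 0 ≡ + 2 ℤ.* c ℤ.+ + 1
    lemma = ℤRing.solve-∀
  ...   | inj₁ f  = inj₁ (found-suc x f)
  ...   | inj₂ eq = inj₂ (ℤ.≤-reflexive (trans (lemma (+ k) (g x)) (sym (cong ℤ.suc
                      (trans (cong g (sym (later k x))) (trans eq (cong (λ t → + k ℤ.+ + k ℤ.+ t) g≡)))))))
    where
    lemma : ∀ k v → (+ 1 ℤ.+ k) ℤ.+ (+ 1 ℤ.+ k) ℤ.+ v ≡ + 1 ℤ.+ (k ℤ.+ k ℤ.+ (+ 1 ℤ.+ v ℤ.+ + 0))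
    lemma = ℤRing.solve-∀
  scan-even (suc k) x (c , gx≡) | sucF 0F , g≡
    with scan-even k (ℤ.suc x) (ℤ.suc c , trans g≡ (trans (cong (λ t → + 1 ℤ.+ t ℤ.+ + 1) gx≡) (lemma c)))
    where
    lemma : ∀ c → + 1 ℤ.+ (+ 2 ℤ.* c) ℤ.+ + 1 ≡ + 2 ℤ.* (+ 1 ℤ.+ c)
    lemma = ℤRing.solve-∀
  ...   | inj₁ f  = inj₁ (found-suc x f)
  ...   | inj₂ le = inj₂ (subst₂ ℤ._≤_ (trans (cong (λ t → + k ℤ.+ + k ℤ.+ t) g≡) (lemma (+ k) (g x)))
                      (cong (λ t → ℤ.suc (g t)) (later k x)) le)
    where
    lemma : ∀ k v → k ℤ.+ k ℤ.+ (+ 1 ℤ.+ v ℤ.+ + 1) ≡ (+ 1 ℤ.+ k) ℤ.+ (+ 1 ℤ.+ k) ℤ.+ v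
    lemma = ℤRing.solve-∀

  module _ (nine : ∀ x → g (+ 9 ℤ.+ x) ℤ.≤ + 16 ℤ.+ g x) where

    find-step : ∀ x → Found 9 x
    find-step x with near-exists 2 (g x)
    ... | c , 0F , gx≡ with scan-even 9 x (c , trans gx≡ (ℤ.+-identityʳ _))
    ...   | inj₁ f  = f
    -- From an even height, nine columns without an odd unit step climb at least 17, one more than
    -- `nine` allows.
    ...   | inj₂ le = contradiction (ℤ.≤-trans le (ℤ.+-monoʳ-≤ (+ 1) (nine x)))
                        (ℤ.<⇒≱ (subst (ℤ._< + 18 ℤ.+ g x) (ℤ.+-assoc (+ 1) (+ 16) (g x)) (ℤ.+-monoˡ-< (g x) (ℤ.+<+ (ℕ.n<1+n 17)))))
    find-step x | c , sucF 0F , gx≡ with scan-odd 9 x (c , gx≡)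
    ...   | inj₁ f  = f
    ...   | inj₂ eq = contradiction (ℤ.≤-trans (ℤ.≤-reflexive (sym eq)) (nine x))
                        (ℤ.<⇒≱ (ℤ.+-monoˡ-< (g x) (ℤ.+<+ (ℕ.m≤m+n 17 1))))

  module _ (two : ∀ x → + 3 ℤ.+ g x ℤ.≤ g (ℤ.suc (ℤ.suc x))) where

    -- Two unit steps in succession would climb only 2, against `two`.
    wide-after : ∀ {x} → g (ℤ.suc x) ≡ + 1 ℤ.+ g x → g (ℤ.suc (ℤ.suc x)) ≡ + 2 ℤ.+ g (ℤ.suc x)
    wide-after {x} short with inc (ℤ.suc x)
    ... | sucF 0F , g≡ = trans g≡ (lemma (g (ℤ.suc x)))
      where
      lemma : ∀ v → + 1 ℤ.+ v ℤ.+ + 1 ≡ + 2 ℤ.+ v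
      lemma = ℤRing.solve-∀
    ... | 0F , g≡ = contradiction (subst (+ 3 ℤ.+ g x ℤ.≤_) (trans g≡ (trans (cong (λ t → + 1 ℤ.+ t ℤ.+ + 0) short) (lemma (g x)))) (two x))
                      (ℤ.<⇒≱ (ℤ.+-monoˡ-< (g x) (ℤ.+<+ (ℕ.n<1+n 2))))
      where
      lemma : ∀ v → + 1 ℤ.+ (+ 1 ℤ.+ v) ℤ.+ + 0 ≡ + 2 ℤ.+ v
      lemma = ℤRing.solve-∀

    wide-before : ∀ {x} → g (ℤ.suc (ℤ.suc x)) ≡ + 1 ℤ.+ g (ℤ.suc x) → g (ℤ.suc x) ≡ + 2 ℤ.+ g x
    wide-before {x} short with inc x
    ... | sucF 0F , g≡ = trans g≡ (lemma (g x))
      where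
      lemma : ∀ v → + 1 ℤ.+ v ℤ.+ + 1 ≡ + 2 ℤ.+ v
      lemma = ℤRing.solve-∀
    ... | 0F , g≡ = contradiction (subst (+ 3 ℤ.+ g x ℤ.≤_) (trans short (trans (cong (λ t → + 1 ℤ.+ t) g≡) (lemma (g x)))) (two x))
                      (ℤ.<⇒≱ (ℤ.+-monoˡ-< (g x) (ℤ.+<+ (ℕ.n<1+n 2))))
      where
      lemma : ∀ v → + 1 ℤ.+ (+ 1 ℤ.+ v ℤ.+ + 0) ≡ + 2 ℤ.+ v
      lemma = ℤRing.solve-∀

    -- Around an odd unit step the heights are v − 2, v, v + 1, v + 3 with v odd.  Replacing v by
    -- v − 1 or v + 1 by v + 2 preserves halves; the first preserves thirds unless 3 ∣ v.
    raise-swap : ∀ {x} → OddUnitStep x → (∃[ l ] g x ≡ + 3 ℤ.* l) → Swap g (ℤ.suc x)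
    raise-swap {x} ((c , odd) , short) (l , gx≡) = record
      { value   = ℤ.suc (g (ℤ.suc x))
      ; changed = λ eq → ℤ.i≢suc[i] (sym eq)
      ; half    = ℤ.suc c , (0F , trans short (trans (cong ℤ.suc odd) (h₀ c)))
                          , (sucF 0F , trans (cong ℤ.suc (trans short (cong ℤ.suc odd))) (h₁ c))
      ; third   = l , (sucF 0F , trans short (trans (cong ℤ.suc gx≡) (t₁ l)))
                    , (sucF (sucF 0F) , trans (cong ℤ.suc (trans short (cong ℤ.suc gx≡))) (t₂ l))
      ; left    = λ x′ eq → subst (λ y → Inc C (g y) _) (sucℤ-injective (sym eq))
                    (sucF 0F , trans (cong ℤ.suc short) (l₁ (g x)))
      ; right   = 0F , trans (wide-after short) (rʳ (g (ℤ.suc x)))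
      }
      where
      h₀ : ∀ c → + 1 ℤ.+ (+ 2 ℤ.* c ℤ.+ + 1) ≡ + 2 ℤ.* (+ 1 ℤ.+ c) ℤ.+ + 0
      h₀ = ℤRing.solve-∀
      h₁ : ∀ c → + 1 ℤ.+ (+ 1 ℤ.+ (+ 2 ℤ.* c ℤ.+ + 1)) ≡ + 2 ℤ.* (+ 1 ℤ.+ c) ℤ.+ + 1
      h₁ = ℤRing.solve-∀
      t₁ : ∀ l → + 1 ℤ.+ + 3 ℤ.* l ≡ + 3 ℤ.* l ℤ.+ + 1
      t₁ = ℤRing.solve-∀
      t₂ : ∀ l → + 1 ℤ.+ (+ 1 ℤ.+ + 3 ℤ.* l) ≡ + 3 ℤ.* l ℤ.+ + 2
      t₂ = ℤRing.solve-∀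
      l₁ : ∀ v → + 1 ℤ.+ (+ 1 ℤ.+ v) ≡ + 1 ℤ.+ v ℤ.+ + 1
      l₁ = ℤRing.solve-∀
      rʳ : ∀ v → + 2 ℤ.+ v ≡ + 1 ℤ.+ (+ 1 ℤ.+ v) ℤ.+ + 0
      rʳ = ℤRing.solve-∀

    -- The remainder modulo 3 is written `suc (toℕ e)`, hence positive, so that a decrease by 1
    -- keeps the quotient.
    lower-swap : ∀ {x} → OddUnitStep x → ∀ l (e : Fin 2) → g x ≡ + 3 ℤ.* l ℤ.+ + suc (toℕ e) → Swap g x
    lower-swap {x} ((c , odd) , short) l e gx≡ = record
      { value   = v
      ; changed = λ eq → ℤ.i≢suc[i] (trans eq (sym suc-v))
      ; half    = c , (sucF 0F , odd) , (0F , trans (cong ℤ.pred odd) (h₀ c))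
      ; third   = l , (sucF e , gx≡)
                    , (fromℕ< e<3 , trans (cong ℤ.pred gx≡) (trans (t₀ l (+ toℕ e))
                        (cong (λ n → + 3 ℤ.* l ℤ.+ + n) (sym (Fin.toℕ-fromℕ< e<3)))))
      ; left    = λ { x′ refl → 0F , trans (cong ℤ.pred (wide-before short)) (l₀ (g x′)) }
      ; right   = sucF 0F , trans short (r₁ (g x))
      }
      where
      v = ℤ.pred (g x)
      suc-v : ℤ.suc v ≡ g x
      suc-v = ℤ.suc-pred (g x)
      e<3 : toℕ e ℕ.< 3
      e<3 = ℕ.m<n⇒m<1+n (Fin.toℕ<n e)
      h₀ : ∀ c → ℤ.- + 1 ℤ.+ (+ 2 ℤ.* c ℤ.+ + 1) ≡ + 2 ℤ.* c ℤ.+ + 0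
      h₀ = ℤRing.solve-∀
      t₀ : ∀ l e → ℤ.- + 1 ℤ.+ (+ 3 ℤ.* l ℤ.+ (+ 1 ℤ.+ e)) ≡ + 3 ℤ.* l ℤ.+ e
      t₀ = ℤRing.solve-∀
      l₀ : ∀ v → ℤ.- + 1 ℤ.+ (+ 2 ℤ.+ v) ≡ + 1 ℤ.+ v ℤ.+ + 0
      l₀ = ℤRing.solve-∀
      r₁ : ∀ v → + 1 ℤ.+ v ≡ + 1 ℤ.+ (ℤ.- + 1 ℤ.+ v) ℤ.+ + 1
      r₁ = ℤRing.solve-∀

    nearby-swap : ∀ {k x} → Found k x → ∃[ n ] n ℕ.≤ k × Swap g (+ n ℤ.+ x)
    nearby-swap {k} {x} (n , n<k , step) with near-exists 3 (g (+ n ℤ.+ x))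
    -- When 3 divides the odd height, the second height of the step is changed, one column further
    -- on; this is why the bound is n ≤ k and not n < k.
    ... | l , 0F     , gx≡ = suc n , n<k , subst (Swap g) (sym (ℤ.+-assoc (+ 1) (+ n) x))
                               (raise-swap step (l , trans gx≡ (ℤ.+-identityʳ _)))
    ... | l , sucF e , gx≡ = n , ℕ.<⇒≤ n<k , lower-swap step l e gx≡

good-swap : ∀ {r} → Good r → ∀ x → ∃[ n ] n ℕ.≤ 9 × Swap (height r) (+ n ℤ.+ x)
good-swap {r} (good {p} {q} {b} (≼⁺ lo) (≼⁺ hi)) x =
  nearby-swap (height r) (height-inc r) two {9} {x} (find-step (height r) (height-inc r) nine x)
  where
  instance _ = den≢0 r
  shift : ∀ n x → IsFloor (x ℤ.* + p ℤ.+ + n ℤ.* + p) q (height r (+ n ℤ.+ x))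
  shift n x = subst (λ z → IsFloor z q (height r (+ n ℤ.+ x))) (lemma (+ n) x (+ p)) (height-floor r (+ n ℤ.+ x))
    where
    lemma : ∀ n x p → (n ℤ.+ x) ℤ.* p ≡ x ℤ.* p ℤ.+ n ℤ.* p
    lemma = ℤRing.solve-∀
  two : ∀ x → + 3 ℤ.+ height r x ℤ.≤ height r (ℤ.suc (ℤ.suc x))
  two x = subst (λ y → + 3 ℤ.+ height r x ℤ.≤ height r y) (ℤ.+-assoc (+ 1) (+ 1) x)
    (floor-grow-≥ (height-floor r x) (shift 2 x) 3 (subst₂ ℤ._≤_ (ℤ.pos-* 3 q) (ℤ.pos-* 2 p) (ℤ.+≤+ lo)))
  nine : ∀ x → height r (+ 9 ℤ.+ x) ℤ.≤ + 16 ℤ.+ height r x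
  nine x = floor-grow-≤ (height-floor r x) (shift 9 x) 16 (subst₂ ℤ._≤_ (ℤ.pos-* 9 p) (ℤ.pos-* 16 q) (ℤ.+≤+ hi))

-- Independent changes, one per 16 × 16 block

link-lower : ∀ k k′ {a a′ w} → k ≡ C → SameQuotient 3 a w → Link k k′ a a′ → Link k k′ w a′
link-lower C A {a′ = a′} {w} _ s l = same-quotient {w = w} {a′} s l
link-lower C B _ _ ()
link-lower C C _ _ ()

-- Below a C row lies an A or B row that was doubled into it, so it sees only quotients by 2; the
-- row above a C row, treated in `link-lower`, sees only quotients by 3.
link-upper : ∀ k k′ {a a′ w} → k′ ≡ C → SameQuotient 2 a′ w → Link k k′ a a′ → Link k k′ a w
link-upper A C {a} {w = w} _ s l = same-quotient {w = w} {a} s l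
link-upper B C {a} {w = w} _ s l = same-quotient {w = w} {a} s l
link-upper C C _ _ ()

[d+K*i]/K≡i : ∀ {K d} i .{{_ : NonZero K}} → d ℕ.< K → (d ℕ.+ K ℕ.* i) ℕ./ K ≡ i
[d+K*i]/K≡i {K} {d} i d<K = begin
  (d ℕ.+ K ℕ.* i) ℕ./ K            ≡⟨ ℕ.+-distrib-/-∣ʳ d (ℕ.m∣m*n i) ⟩
  d ℕ./ K ℕ.+ (K ℕ.* i) ℕ./ K      ≡⟨ cong₂ ℕ._+_ (ℕ.m<n⇒m/n≡0 d<K) (trans (cong (ℕ._/ K) (ℕ.*-comm K i)) (ℕ.m*n/n≡m i K)) ⟩
  i                                ∎
  where open ≡-Reasoning

d+K*i<m*K : ∀ {K d i m} → d ℕ.< K → i ℕ.< m → d ℕ.+ K ℕ.* i ℕ.< m ℕ.* K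
d+K*i<m*K {K} {d} {i} {m} d<K i<m = begin-strict
  d ℕ.+ K ℕ.* i     <⟨ ℕ.+-monoˡ-< (K ℕ.* i) d<K ⟩
  K ℕ.+ K ℕ.* i     ≡⟨ ℕ.*-suc K i ⟨
  K ℕ.* suc i       ≤⟨ ℕ.*-monoʳ-≤ K i<m ⟩
  K ℕ.* m           ≡⟨ ℕ.*-comm K m ⟩
  m ℕ.* K           ∎
  where open ℕ.≤-Reasoning

unitRow : Row
unitRow = row C 1 1 (≼⁺ ℕ.≤-refl , ≺⁺ ℕ.≤-refl)

open Orbit unitRow
open Height

ups-+ : ∀ m n r → ups m (ups n r) ≡ ups (m ℕ.+ n) r
ups-+ zero    n r = refl
ups-+ (suc m) n r = cong up (ups-+ m n r)

-- Abstract, since unfolding the positions makes conversion checking explode.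
abstract
  private
    dy : ℕ → ℕ
    dy j = proj₁ (soon (orbit (+ (16 ℕ.* j))))

    dy<16 : ∀ j → dy j ℕ.< 16
    dy<16 j = ℕ.≤-trans (ℕ.s≤s (proj₁ (proj₂ (soon (orbit (+ (16 ℕ.* j))))))) (ℕ.m≤m+n 14 2)

  Y : ℕ → ℕ
  Y j = dy j ℕ.+ 16 ℕ.* j

  Y/16 : ∀ j → Y j ℕ./ 16 ≡ j
  Y/16 j = [d+K*i]/K≡i j (dy<16 j)

  Y<m*16 : ∀ {j m} → j ℕ.< m → Y j ℕ.< m ℕ.* 16
  Y<m*16 {j} = d+K*i<m*K (dy<16 j)

  Y-good : ∀ j → Good (orbit (+ Y j))
  Y-good j = subst Good (ups-+ (dy j) (16 ℕ.* j) unitRow) (proj₂ (proj₂ (soon (orbit (+ (16 ℕ.* j))))))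

  private
    sites : ∀ i j → ∃[ n ] n ℕ.≤ 9 × Swap (height (orbit (+ Y j))) (+ n ℤ.+ + (suc (16 ℕ.* i)))
    sites i j = good-swap (Y-good j) (+ (suc (16 ℕ.* i)))

    dx : ℕ → ℕ → ℕ
    dx i j = suc (proj₁ (sites i j))

    -- The bound is 15 rather than 16 so that the column to the right of a site belongs to the same
    -- block, which makes sites of one row non-adjacent.
    dx<15 : ∀ i j → dx i j ℕ.< 15
    dx<15 i j = ℕ.s≤s (ℕ.≤-trans (ℕ.s≤s (proj₁ (proj₂ (sites i j)))) (ℕ.m≤m+n 10 4))

  X : ℕ → ℕ → ℕ
  X i j = dx i j ℕ.+ 16 ℕ.* i

  X/16 : ∀ i j → X i j ℕ./ 16 ≡ i
  X/16 i j = [d+K*i]/K≡i i (ℕ.m<n⇒m<1+n (dx<15 i j))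

  suc-X/16 : ∀ i j → suc (X i j) ℕ./ 16 ≡ i
  suc-X/16 i j = [d+K*i]/K≡i i (ℕ.s<s (dx<15 i j))

  X<m*16 : ∀ {i j m} → i ℕ.< m → X i j ℕ.< m ℕ.* 16
  X<m*16 {i} {j} = d+K*i<m*K (ℕ.m<n⇒m<1+n (dx<15 i j))

  site : ∀ i j → Swap (height (orbit (+ Y j))) (+ X i j)
  site i j = subst (λ n → Swap (height (orbit (+ Y j))) (+ n)) (ℕ.+-suc (proj₁ (sites i j)) (16 ℕ.* i))
    (proj₂ (proj₂ (sites i j)))

kind-good : ∀ {r} → Good r → kind r ≡ C
kind-good (good _ _) = refl

Y-kind : ∀ j → kind (orbit (+ Y j)) ≡ C
Y-kind j = kind-good (Y-good j)

Y-injective : ∀ {j j′} → Y j ≡ Y j′ → j ≡ j′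
Y-injective {j} {j′} eq = trans (sym (Y/16 j)) (trans (cong (ℕ._/ 16) eq) (Y/16 j′))

X-injective : ∀ {i i′ j} → X i j ≡ X i′ j → i ≡ i′
X-injective {i} {i′} {j} eq = trans (sym (X/16 i j)) (trans (cong (ℕ._/ 16) eq) (X/16 i′ j))

X-isolated : ∀ {i i′ j} → suc (X i j) ≢ X i′ j
X-isolated {i} {i′} {j} eq with trans (sym (suc-X/16 i j)) (trans (cong (ℕ._/ 16) eq) (X/16 i′ j))
... | refl = ℕ.1+n≢n eq

module Flip (b : ℕ → ℕ → Bool) where

  Selected : ℤ → ℤ → Set
  Selected y x = ∃[ i ] ∃[ j ] x ≡ + X i j × y ≡ + Y j × b i j ≡ true

  -- Division by 16 recovers the only block whose site can be at the given position.
  selected? : ∀ y x → Dec (Selected y x)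
  selected? -[1+ _ ] _        = no λ ()
  selected? (+ _)    -[1+ _ ] = no λ ()
  selected? (+ n) (+ m) = map′ (λ { (p , q , t) → i , j , cong +_ p , cong +_ q , t })
    (λ { (i′ , j′ , refl , refl , t) → locate i′ j′ refl refl t })
    (m ℕ.≟ X i j ×-dec n ℕ.≟ Y j ×-dec b i j Bool.≟ true)
    where
    i = m ℕ./ 16
    j = n ℕ./ 16
    locate : ∀ i′ j′ → m ≡ X i′ j′ → n ≡ Y j′ → b i′ j′ ≡ true → m ≡ X i j × n ≡ Y j × b i j ≡ true
    locate i′ j′ refl refl t rewrite Y/16 j′ | X/16 i′ j′ = refl , refl , t

  -- The decision is an argument, so that `flip-inc` and `flip-link` can go through all pairs of
  -- outcomes at two neighbouring positions.
  pick : ∀ {y x} → Dec (Selected y x) → ℤ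
  pick         (yes (i , j , _)) = Swap.value (site i j)
  pick {y} {x} (no _)            = val beatty y x

  flip-inc : ∀ y x d d′ → Inc (kind (orbit y)) (pick {y} {x} d) (pick {y} {ℤ.suc x} d′)
  flip-inc y x (yes (i , j , refl , refl , _)) (yes (i′ , j′ , p , q , _))
    with refl ← Y-injective (ℤ.+-injective q) = contradiction (ℤ.+-injective p) X-isolated
  flip-inc y x (yes (i , j , refl , refl , _)) (no _) =
    subst (λ k → Inc k (Swap.value (site i j)) (val beatty y (ℤ.suc x))) (sym (Y-kind j)) (Swap.right (site i j))
  flip-inc y x (no _) (yes (i , j , p , refl , _)) =
    subst (λ k → Inc k (val beatty y x) (Swap.value (site i j))) (sym (Y-kind j)) (Swap.left (site i j) x p)
  flip-inc y x (no _) (no _) = inc beatty y x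

  flip-link : ∀ y x d d′ → Link (kind (orbit y)) (kind (orbit (ℤ.suc y))) (pick {y} {x} d) (pick {ℤ.suc y} {x} d′)
  flip-link y x (no _)  (no _)  = link beatty y x
  flip-link y x (yes (i , j , refl , refl , _)) (no _) =
    link-lower _ _ (Y-kind j) (Swap.third (site i j)) (link beatty y x)
  flip-link y x (no _) (yes (i , j , refl , q , _)) =
    link-upper _ _ (trans (cong (λ y → kind (orbit y)) q) (Y-kind j))
      (subst (λ y → SameQuotient 2 (val beatty y x) (Swap.value (site i j))) (sym q) (Swap.half (site i j)))
      (link beatty y x)
  -- Two changed rows, one directly above the other, would both be of kind C, which `Link` excludes.
  flip-link y x (yes (i , j , refl , refl , _)) (yes (i′ , j′ , _ , q , _)) = contradiction
    (subst₂ (λ k k′ → Link k k′ (val beatty y x) (val beatty (ℤ.suc y) x)) (Y-kind j)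
      (trans (cong (λ y → kind (orbit y)) q) (Y-kind j′)) (link beatty y x)) λ ()

  flip : Height (λ y → kind (orbit y))
  flip = record
    { val  = λ y x → pick (selected? y x)
    ; inc  = λ y x → flip-inc y x (selected? y x) (selected? y (ℤ.suc x))
    ; link = λ y x → flip-link y x (selected? y x) (selected? (ℤ.suc y) x)
    }

  flip-on : ∀ i j → b i j ≡ true → val flip (+ Y j) (+ X i j) ≡ Swap.value (site i j)
  flip-on i j t with selected? (+ Y j) (+ X i j)
  ... | no ¬s = contradiction (i , j , refl , refl , t) ¬s
  ... | yes (i′ , j′ , p , q , _)
    with refl ← Y-injective {j} {j′} (ℤ.+-injective q)
    with refl ← X-injective {i} {i′} {j} (ℤ.+-injective p) = refl

  flip-off : ∀ i j → b i j ≡ false → val flip (+ Y j) (+ X i j) ≡ val beatty (+ Y j) (+ X i j)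
  flip-off i j f with selected? (+ Y j) (+ X i j)
  ... | no _ = refl
  ... | yes (i′ , j′ , p , q , t)
    with refl ← Y-injective {j} {j′} (ℤ.+-injective q)
    with refl ← X-injective {i} {i′} {j} (ℤ.+-injective p) = contradiction (trans (sym t) f) λ ()

  flip-next : ∀ i j → val flip (+ Y j) (ℤ.suc (+ X i j)) ≡ val beatty (+ Y j) (ℤ.suc (+ X i j))
  flip-next i j with selected? (+ Y j) (ℤ.suc (+ X i j))
  ... | no _ = refl
  ... | yes (i′ , j′ , p , q , _)
    with refl ← Y-injective {j} {j′} (ℤ.+-injective q) = contradiction (ℤ.+-injective p) X-isolated

open Flip using (flip; flip-on; flip-off; flip-next)

inc-cancel : ∀ k {a a′ v v′} (i : Inc k a v) (i′ : Inc k a′ v′) → proj₁ i ≡ proj₁ i′ → v ≡ v′ → a ≡ a′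
inc-cancel k {a} {a′} (e , v≡) (e , v′≡) refl refl = begin
  a                                       ≡⟨ strip (+ base k) a (+ toℕ e) ⟨
  (+ base k ℤ.+ a) ℤ.+ + toℕ e ℤ.- + toℕ e ℤ.- + base k
    ≡⟨ cong (λ t → t ℤ.- + toℕ e ℤ.- + base k) (trans (sym v≡) v′≡) ⟩
  (+ base k ℤ.+ a′) ℤ.+ + toℕ e ℤ.- + toℕ e ℤ.- + base k
    ≡⟨ strip (+ base k) a′ (+ toℕ e) ⟩
  a′                                      ∎
  where
  open ≡-Reasoning
  strip : ∀ β a e → (β ℤ.+ a) ℤ.+ e ℤ.- e ℤ.- β ≡ a
  strip = ℤRing.solve-∀

-- The bottom colour records the increment to the next column, where the height does not depend on
-- the choices. Equal tiles would therefore force equal heights at the site.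
flip-cell-≢ : ∀ b b′ i j → b i j ≡ true → b′ i j ≡ false →
              cell (flip b) (+ X i j) (+ Y j) ≢ cell (flip b′) (+ X i j) (+ Y j)
flip-cell-≢ b b′ i j t f eq = Swap.changed (site i j)
  (trans (sym (flip-on b i j t)) (trans same (flip-off b′ i j f)))
  where
  x = + X i j
  y = + Y j
  k = kind (orbit y)
  d≡ : proj₁ (inc (flip b) y x) ≡ proj₁ (inc (flip b′) y x)
  d≡ = hcol-injective k (cong bottom eq)
  same : val (flip b) y x ≡ val (flip b′) y x
  same = inc-cancel k (inc (flip b) y x) (inc (flip b′) y x) d≡ (trans (flip-next b i j) (sym (flip-next b′ i j)))

flip-cell-injective : ∀ b b′ i j →
  cell (flip b) (+ X i j) (+ Y j) ≡ cell (flip b′) (+ X i j) (+ Y j) → b i j ≡ b′ i j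
flip-cell-injective b b′ i j eq with b i j in p | b′ i j in q
... | true  | true  = refl
... | false | false = refl
... | true  | false = contradiction eq (flip-cell-≢ b b′ i j p q)
... | false | true  = contradiction (sym eq) (flip-cell-≢ b′ b i j q p)

-- Counting patterns

unique-⊆⇒length≤ : {S : Set} {xs ys : List S} → Unique xs → (∀ {x} → x ∈ xs → x ∈ ys) → length xs ℕ.≤ length ys
unique-⊆⇒length≤ [] _ = ℕ.z≤n
unique-⊆⇒length≤ {xs = x ∷ xs} (x∉xs ∷ xs!) xs⊆ys with ∈-∃++ (xs⊆ys (here refl))
... | ys₁ , ys₂ , refl = begin
  suc (length xs)                  ≤⟨ ℕ.s≤s (unique-⊆⇒length≤ xs! avoid) ⟩
  suc (length (ys₁ ++ ys₂))        ≡⟨ cong suc (List.length-++ ys₁) ⟩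
  suc (length ys₁ ℕ.+ length ys₂)  ≡⟨ ℕ.+-suc (length ys₁) (length ys₂) ⟨
  length ys₁ ℕ.+ length (x ∷ ys₂)  ≡⟨ List.length-++ ys₁ ⟨
  length (ys₁ ++ x ∷ ys₂)          ∎
  where
  open ℕ.≤-Reasoning
  avoid : ∀ {z} → z ∈ xs → z ∈ ys₁ ++ ys₂
  avoid z∈xs with ∈-++⁻ ys₁ (xs⊆ys (there z∈xs))
  ... | inj₁ z∈ys₁         = ∈-++⁺ˡ z∈ys₁
  ... | inj₂ (here refl)   = contradiction refl (All.lookup x∉xs z∈xs)
  ... | inj₂ (there z∈ys₂) = ∈-++⁺ʳ ys₁ z∈ys₂

length-cartesianProductWith : {S U W : Set} (f : S → U → W) (xs : List S) (ys : List U) →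
  length (cartesianProductWith f xs ys) ≡ length xs ℕ.* length ys
length-cartesianProductWith f []       ys = refl
length-cartesianProductWith f (x ∷ xs) ys = trans (List.length-++ (map (f x) ys))
  (cong₂ ℕ._+_ (List.length-map (f x) ys) (length-cartesianProductWith f xs ys))

vecs : {S : Set} → List S → ∀ n → List (Vec S n)
vecs xs zero    = [] ∷ []
vecs xs (suc n) = cartesianProductWith _∷_ xs (vecs xs n)

module _ {S : Set} where

  length-vecs : ∀ (xs : List S) n → length (vecs xs n) ≡ length xs ℕ.^ n
  length-vecs xs zero    = refl
  length-vecs xs (suc n) = trans (length-cartesianProductWith _∷_ xs (vecs xs n))
    (cong (length xs ℕ.*_) (length-vecs xs n))

  ∈-vecs : ∀ {xs : List S} {n} (v : Vec S n) → (∀ i → lookup v i ∈ xs) → v ∈ vecs xs n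
  ∈-vecs []      _ = here refl
  ∈-vecs (x ∷ v) h = ∈-cartesianProductWith⁺ _∷_ (h 0F) (∈-vecs v (h ∘ sucF))

  vecs-unique : ∀ {xs : List S} n → Unique xs → Unique (vecs xs n)
  vecs-unique zero    _   = All.[] ∷ []
  vecs-unique (suc n) xs! = Unique.cartesianProductWith⁺ _∷_ Vec.∷-injective xs! (vecs-unique n xs!)

  lookup-ext : ∀ {n} {u v : Vec S n} → (∀ i → lookup u i ≡ lookup v i) → u ≡ v
  lookup-ext {u = u} {v} h = trans (sym (Vec.tabulate∘lookup u)) (trans (Vec.tabulate-cong h) (Vec.tabulate∘lookup v))

length-vecs² : {S : Set} (xs : List S) (m : ℕ) → length (vecs (vecs xs m) m) ≡ length xs ℕ.^ (m ℕ.* m)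
length-vecs² xs m = trans (length-vecs (vecs xs m) m)
  (trans (cong (ℕ._^ m) (length-vecs xs m)) (ℕ.^-*-assoc (length xs) m m))

∈-vecs² : {S : Set} {xs : List S} {m : ℕ} (v : Vec (Vec S m) m) →
          (∀ i j → lookup (lookup v j) i ∈ xs) → v ∈ vecs (vecs xs m) m
∈-vecs² v h = ∈-vecs v λ j → ∈-vecs (lookup v j) λ i → h i j

lookup²-ext : {S : Set} {m n : ℕ} {u v : Vec (Vec S m) n} →
              (∀ i j → lookup (lookup u j) i ≡ lookup (lookup v j) i) → u ≡ v
lookup²-ext h = lookup-ext λ j → lookup-ext λ i → h i j

grid : {S : Set} {m n : ℕ} → (Fin m → Fin n → S) → Vec (Vec S m) n
grid g = tabulate λ j → tabulate λ i → g i j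

lookup-grid : {S : Set} {m n : ℕ} (g : Fin m → Fin n → S) → ∀ i j → lookup (lookup (grid g) j) i ≡ g i j
lookup-grid g i j = trans (cong (λ v → lookup v i) (Vec.lookup∘tabulate (λ j → tabulate λ i → g i j) j))
  (Vec.lookup∘tabulate (λ i → g i j) i)

window : {S : Set} → (ℤ → ℤ → S) → ℤ → ℤ → (n : ℕ) → Vec (Vec S n) n
window f x y n = grid λ i j → f (x ℤ.+ + toℕ i) (y ℤ.+ + toℕ j)

module Counting (em : ExcludedMiddle 0ℓ) {V H : Set} (T : List (WangTile V H)) where

  -- Occurrence quantifies over all tilings of the plane, so excluded middle is used to decide it.
  occurs? : ∀ n → Decidable (Occurs T n)
  occurs? n P = em

  _≟_ : ∀ {S : Set} → DecidableEquality S
  x ≟ y = em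

  patterns : ∀ n → List (Vec (Vec (WangTile V H) n) n)
  patterns n = filter (occurs? n) (deduplicate _≟_ (vecs (vecs T n) n))

  count : ℕ → ℕ
  count n = length (patterns n)

  patterns-unique : ∀ n → Unique (patterns n)
  patterns-unique n = Unique.filter⁺ (occurs? n) (DecUnique.deduplicate-! _≟_ (vecs (vecs T n) n))

  occurs⇒∈ : ∀ {n P} → Occurs T n P → P ∈ patterns n
  occurs⇒∈ {n} {P} o@(f , t , x , y , h) = ∈-filter⁺ (occurs? n) (∈-deduplicate⁺ _≟_
    (∈-vecs² P λ i j → subst (_∈ T) (sym (h i j)) (IsTiling.inT t _ _))) o

  ∈⇒occurs : ∀ {n P} → P ∈ patterns n → Occurs T n P
  ∈⇒occurs {n} P∈ = proj₂ (∈-filter⁻ (occurs? n) {xs = deduplicate _≟_ (vecs (vecs T n) n)} P∈)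

  cardinality : ∀ n → HasCardinality (Occurs T n) (count n)
  cardinality n = patterns n , patterns-unique n , (λ P → mk⇔ (∈⇒occurs {n} {P}) occurs⇒∈) , refl

  window-∈ : ∀ {f} → IsTiling T f → ∀ x y n → window f x y n ∈ patterns n
  window-∈ {f} t x y n = occurs⇒∈ (f , t , x , y , lookup-grid _)

  count≢0 : TilesPlane T → ∀ n → NonZero (count n)
  count≢0 (f , t) n = ℕ.>-nonZero (∈-length (window-∈ t (+ 0) (+ 0) n))

  module _ (k m n : ℕ) (n≤mk : n ℕ.≤ m ℕ.* k) where

    block : Fin n → Fin m
    block i = proj₁ (remQuot k (inject≤ i n≤mk))

    offset : Fin n → Fin k
    offset i = proj₂ (remQuot {m} k (inject≤ i n≤mk))

    block-offset : ∀ i → k ℕ.* toℕ (block i) ℕ.+ toℕ (offset i) ≡ toℕ i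
    block-offset i = trans (sym (Fin.toℕ-combine (block i) (offset i)))
      (trans (cong toℕ (Fin.combine-remQuot {m} k (inject≤ i n≤mk))) (Fin.toℕ-inject≤ i n≤mk))

    assemble : Vec (Vec (Vec (Vec (WangTile V H) k) k) m) m → Vec (Vec (WangTile V H) n) n
    assemble Q = grid λ i j → lookup (lookup (lookup (lookup Q (block j)) (block i)) (offset j)) (offset i)

    -- A pattern is determined by m² windows of side k that cover it. Allowing n ≤ m k makes every
    -- side n accessible to a fixed k.
    count-submultiplicative : count n ℕ.≤ count k ℕ.^ (m ℕ.* m)
    count-submultiplicative = ℕ.≤-trans (unique-⊆⇒length≤ (patterns-unique n) covered)
      (ℕ.≤-reflexive (trans (List.length-map assemble (vecs (vecs (patterns k) m) m)) (length-vecs² (patterns k) m)))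
      where
      covered : ∀ {P} → P ∈ patterns n → P ∈ map assemble (vecs (vecs (patterns k) m) m)
      covered {P} P∈ with ∈⇒occurs {n} {P} P∈
      ... | f , t , x , y , h = subst (_∈ map assemble _) (lookup²-ext agree)
        (∈-map⁺ assemble (∈-vecs² Q λ I J → subst (_∈ patterns k) (sym (lookup-grid piece I J)) (window-∈ t (x ℤ.+ + (k ℕ.* toℕ I)) (y ℤ.+ + (k ℕ.* toℕ J)) k)))
        where
        -- Pieces are cut from the tiling and not from `P`, since the last blocks may stick out of
        -- `P`.
        piece : Fin m → Fin m → Vec (Vec (WangTile V H) k) k
        piece I J = window f (x ℤ.+ + (k ℕ.* toℕ I)) (y ℤ.+ + (k ℕ.* toℕ J)) k
        Q = grid piece
        shift : ∀ x i → x ℤ.+ + (k ℕ.* toℕ (block i)) ℤ.+ + toℕ (offset i) ≡ x ℤ.+ + toℕ i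
        shift x i = trans (ℤ.+-assoc x _ _) (cong (λ n → x ℤ.+ + n) (block-offset i))
        agree : ∀ i j → lookup (lookup (assemble Q) j) i ≡ lookup (lookup P j) i
        agree i j = begin
          lookup (lookup (assemble Q) j) i
            ≡⟨ lookup-grid _ i j ⟩
          lookup (lookup (lookup (lookup Q (block j)) (block i)) (offset j)) (offset i)
            ≡⟨ cong (λ R → lookup (lookup R (offset j)) (offset i)) (lookup-grid piece (block i) (block j)) ⟩
          lookup (lookup (piece (block i) (block j)) (offset j)) (offset i)
            ≡⟨ lookup-grid _ (offset i) (offset j) ⟩
          f (x ℤ.+ + (k ℕ.* toℕ (block i)) ℤ.+ + toℕ (offset i)) (y ℤ.+ + (k ℕ.* toℕ (block j)) ℤ.+ + toℕ (offset j))
            ≡⟨ cong₂ f (shift x i) (shift y j) ⟩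
          f (x ℤ.+ + toℕ i) (y ℤ.+ + toℕ j)
            ≡⟨ h i j ⟨
          lookup (lookup P j) i ∎
          where open ≡-Reasoning

-- Infimum of the normalised logarithms

fraction : ℕ → ℚᵘ
fraction k = mkℚᵘ (+ k) 0

fraction-suc : ∀ k δ → fraction (suc k) ℚ.* δ ≃ fraction k ℚ.* δ ℚ.+ δ
fraction-suc k δ = begin
  fraction (suc k) ℚ.* δ               ≈⟨ ℚ.*-congʳ {δ} suc≃ ⟩
  (fraction k ℚ.+ 1ℚᵘ) ℚ.* δ           ≈⟨ ℚ.*-distribʳ-+ δ (fraction k) 1ℚᵘ ⟩
  fraction k ℚ.* δ ℚ.+ 1ℚᵘ ℚ.* δ       ≈⟨ ℚ.+-congʳ (fraction k ℚ.* δ) (ℚ.*-identityˡ δ) ⟩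
  fraction k ℚ.* δ ℚ.+ δ               ∎
  where
  open ℚ.≃-Reasoning
  suc≃ : fraction (suc k) ≃ fraction k ℚ.+ 1ℚᵘ
  suc≃ = *≡* (cong (λ n → n ℤ.* + 1) (trans (cong +_ (ℕ.+-comm 1 k)) (cong (ℤ._+ + 1) (sym (ℤ.*-identityʳ (+ k))))))

archimedean : ∀ q δ → 0ℚᵘ ℚ.< δ → ∃[ k ] q ℚ.< fraction k ℚ.* δ
archimedean q (mkℚᵘ (+ zero)  e) (*<* (ℤ.+<+ ()))
archimedean q (mkℚᵘ -[1+ _ ]  e) (*<* ())
-- After cross-multiplication the multiple only has to exceed ∣n∣ (e + 1), the other factors being
-- at least 1.
archimedean (mkℚᵘ n d) (mkℚᵘ (+ suc x) e) _ = suc a , *<* (begin-strict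
  n ℤ.* + (1 ℕ.* suc e)                  ≤⟨ ℤ.*-monoʳ-≤-nonNeg (+ (1 ℕ.* suc e)) (i≤∣i∣ n) ⟩
  + ℤ.∣ n ∣ ℤ.* + (1 ℕ.* suc e)          ≡⟨ ℤ.pos-* ℤ.∣ n ∣ (1 ℕ.* suc e) ⟨
  + a                                    <⟨ ℤ.+<+ (ℕ.n<1+n a) ⟩
  + suc a                                ≤⟨ ℤ.+≤+ (ℕ.≤-trans (ℕ.m≤m*n (suc a) (suc x)) (ℕ.m≤m*n (suc a ℕ.* suc x) (suc d))) ⟩
  + (suc a ℕ.* suc x ℕ.* suc d)          ≡⟨ ℤ.pos-* (suc a ℕ.* suc x) (suc d) ⟩
  + (suc a ℕ.* suc x) ℤ.* + suc d        ≡⟨ cong (ℤ._* + suc d) (ℤ.pos-* (suc a) (suc x)) ⟩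
  (+ suc a ℤ.* + suc x) ℤ.* + suc d      ∎)
  where
  open ℤ.≤-Reasoning
  a = ℤ.∣ n ∣ ℕ.* (1 ℕ.* suc e)
  i≤∣i∣ : ∀ i → i ℤ.≤ + ℤ.∣ i ∣
  i≤∣i∣ (+ _)    = ℤ.≤-refl
  i≤∣i∣ -[1+ _ ] = ℤ.-≤+

halve : ∀ {ε} → 0ℚᵘ ℚ.< ε → 0ℚᵘ ℚ.< ε ℚ.* ½
halve {ε} 0<ε = ℚ.<-respˡ-≃ (ℚ.*-zeroˡ ½) (ℚ.*-monoˡ-<-pos ½ 0<ε)

halves : ∀ ε → ε ℚ.* ½ ℚ.+ ε ℚ.* ½ ≃ ε
halves ε = ℚ.≃-trans (ℚ.≃-sym (ℚ.*-distribˡ-+ ε ½ ½))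
  (ℚ.≃-trans (ℚ.*-congˡ {ε} (*≡* refl)) (ℚ.*-identityʳ ε))

<-+ : ∀ p {q} → 0ℚᵘ ℚ.< q → p ℚ.< p ℚ.+ q
<-+ p 0<q = ℚ.<-respˡ-≃ (ℚ.+-identityʳ p) (ℚ.+-monoʳ-< p 0<q)

module _ (x : ℝ) (0<x : Positive x) (em : ExcludedMiddle 0ℓ) where
  open ℝ x

  -- Archimedean descent through the multiples of δ = ε/2.
  enclose : ∀ {ε} → 0ℚᵘ ℚ.< ε → ∃[ q ] lower q × upper (q ℚ.+ ε)
  enclose {ε} 0<ε = go (proj₁ big) (upper-closed (proj₂ big) (proj₂ upper-inhabited))
    where
    δ = ε ℚ.* ½
    0<δ = halve 0<ε
    big = archimedean (proj₁ upper-inhabited) δ 0<δ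
    go : ∀ k → upper (fraction k ℚ.* δ) → ∃[ q ] lower q × upper (q ℚ.+ ε)
    go zero    u = contradiction (upper-resp (ℚ.*-zeroˡ δ) u) (disjoint 0<x)
    go (suc k) u with em {upper (fraction k ℚ.* δ)}
    ... | yes u′ = go k u′
    -- That kδ is not an upper point does not put it in the lower cut, but by locatedness kδ - δ is
    -- there. The enclosure then has width 2δ = ε.
    ... | no ¬u′ = kδ ℚ.- δ , lower-q (located kδ-δ<kδ) , upper-resp sum≃ u
      where
      kδ = fraction k ℚ.* δ
      cancel : kδ ℚ.- δ ℚ.+ δ ≃ kδ
      cancel = ℚ.≃-trans (ℚ.+-assoc kδ (ℚ.- δ) δ)
        (ℚ.≃-trans (ℚ.+-congʳ kδ (ℚ.+-inverseˡ δ)) (ℚ.+-identityʳ kδ))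
      kδ-δ<kδ : kδ ℚ.- δ ℚ.< kδ
      kδ-δ<kδ = ℚ.<-respʳ-≃ cancel (<-+ (kδ ℚ.- δ) 0<δ)
      lower-q : lower (kδ ℚ.- δ) ⊎ upper kδ → lower (kδ ℚ.- δ)
      lower-q (inj₁ l)  = l
      lower-q (inj₂ u′) = contradiction u′ ¬u′
      sum≃ : fraction (suc k) ℚ.* δ ≃ kδ ℚ.- δ ℚ.+ ε
      sum≃ = begin
        fraction (suc k) ℚ.* δ       ≈⟨ fraction-suc k δ ⟩
        kδ ℚ.+ δ                     ≈⟨ ℚ.+-congˡ δ cancel ⟨
        kδ ℚ.- δ ℚ.+ δ ℚ.+ δ         ≈⟨ ℚ.+-assoc (kδ ℚ.- δ) δ δ ⟩
        kδ ℚ.- δ ℚ.+ (δ ℚ.+ δ)       ≈⟨ ℚ.+-congʳ (kδ ℚ.- δ) (halves ε) ⟩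
        kδ ℚ.- δ ℚ.+ ε               ∎
        where open ℚ.≃-Reasoning

module Infimum (em : ExcludedMiddle 0ℓ) (a : ℕ → ℝ) {b : ℚᵘ} (0<b : 0ℚᵘ ℚ.< b)
               (bounded : ∀ n → ¬ ℝ.upper (a n) b) where

  private module a n = ℝ (a n)

  -- A lower bound strictly above q is required because the lower cut has to be open.
  inf : ℝ
  inf = record
    { lower           = λ q → ∃[ r ] q ℚ.< r × (∀ n → ¬ a.upper n r)
    ; upper           = λ q → ∃[ n ] a.upper n q
    ; lower-inhabited = 0ℚᵘ , b , 0<b , bounded
    ; upper-inhabited = let q , u = a.upper-inhabited 0 in q , 0 , u
    ; lower-closed    = λ { q<r (s , r<s , h) → s , ℚ.<-trans q<r r<s , h }
    ; upper-closed    = λ { q<r (n , u) → n , a.upper-closed n q<r u }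
    ; lower-open      = λ { (r , q<r , h) → let m , q<m , m<r = ℚ.<-dense q<r in m , q<m , r , m<r , h }
    ; upper-open      = λ { (n , u) → let r , r<q , u′ = a.upper-open n u in r , r<q , n , u′ }
    ; disjoint        = λ { (r , q<r , h) (n , u) → h n (a.upper-closed n q<r u) }
    ; located         = located′
    }
    where
    located′ : ∀ {q r} → q ℚ.< r → (∃[ s ] q ℚ.< s × (∀ n → ¬ a.upper n s)) ⊎ (∃[ n ] a.upper n r)
    located′ {q} {r} q<r with em {∃[ n ] a.upper n r}
    ... | yes u = inj₂ u
    ... | no ¬u = inj₁ (r , q<r , λ n u → ¬u (n , u))

  inf-positive : Positive inf
  inf-positive = b , 0<b , bounded

  -- The hypothesis turns an upper bound of one term into a slightly larger upper bound of all late
  -- terms. Applied to a term less than ε/2 above a lower point q, it holds the sequence below q +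
  -- ε.
  inf-limit : (∀ k {q r} → q ℚ.< r → a.upper k q → ∃[ N ] ∀ n → N ℕ.≤ n → a.upper n r) → a ⟶ inf
  inf-limit settle ε 0<ε with enclose inf inf-positive em (halve 0<ε)
  ... | q , l@(r , q<r , h) , k , u = let N , eventually = settle k q+δ<q+ε u in
    N , λ n N≤n →
      (q , (k , a.upper-closed k q+δ<q--ε u) , lower-q n (a.located n q<r)) ,
      (q ℚ.+ ε , eventually n N≤n , ℝ.lower-resp inf (ℚ.≃-sym cancel) l)
    where
    δ = ε ℚ.* ½
    δ<ε : δ ℚ.< ε
    δ<ε = ℚ.<-respʳ-≃ (halves ε) (<-+ δ (halve 0<ε))
    q+δ<q+ε : q ℚ.+ δ ℚ.< q ℚ.+ ε
    q+δ<q+ε = ℚ.+-monoʳ-< q δ<ε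
    q+δ<q--ε : q ℚ.+ δ ℚ.< q ℚ.- (ℚ.- ε)
    q+δ<q--ε = ℚ.<-respʳ-≃ (ℚ.+-congʳ q (ℚ.≃-sym (ℚ.neg-involutive ε))) q+δ<q+ε
    cancel : q ℚ.+ ε ℚ.- ε ≃ q
    cancel = ℚ.≃-trans (ℚ.+-assoc q ε (ℚ.- ε))
      (ℚ.≃-trans (ℚ.+-congʳ q (ℚ.+-inverseʳ ε)) (ℚ.+-identityʳ q))
    lower-q : ∀ n → a.lower n q ⊎ a.upper n r → a.lower n q
    lower-q n (inj₁ l) = l
    lower-q n (inj₂ u) = contradiction u (h n)

-- Fekete's argument for squares

module Fekete (c : ℕ → ℕ) (c≢0 : ∀ n → NonZero (c n))
              (submultiplicative : ∀ k m n → n ℕ.≤ m ℕ.* k → c n ℕ.≤ c k ℕ.^ (m ℕ.* m)) where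

  a : ℕ → ℝ
  a n = log₂ (c (suc n)) {{c≢0 (suc n)}} ÷ (suc n ℕ.* suc n)

  -- This is log₂ (c n) / n² < p / (d + 1) with denominators cleared.
  ScaledUpper : ℕ → ℕ → ℕ → Set
  ScaledUpper n p d = c n ℕ.^ suc d ℕ.< 2 ℕ.^ (p ℕ.* (n ℕ.* n))

  private
    scale≡ : ∀ n p d → mkℚᵘ (+ p) d ℚ.* fraction (suc n ℕ.* suc n) ≡ mkℚᵘ (+ (p ℕ.* (suc n ℕ.* suc n))) d
    scale≡ n p d = cong₂ mkℚᵘ (sym (ℤ.pos-* p (suc n ℕ.* suc n))) (ℕ.*-identityʳ d)

  upper⇒ : ∀ n p d → ℝ.upper (a n) (mkℚᵘ (+ p) d) → ScaledUpper (suc n) p d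
  upper⇒ n p d = subst (Log₂.Upper (c (suc n))) (scale≡ n p d)

  upper⇐ : ∀ n p d → ScaledUpper (suc n) p d → ℝ.upper (a n) (mkℚᵘ (+ p) d)
  upper⇐ n p d = subst (Log₂.Upper (c (suc n))) (sym (scale≡ n p d))

  ceiling-multiple : ∀ s N .{{_ : NonZero s}} → ∃[ m ] N ℕ.≤ m ℕ.* s × m ℕ.* s ℕ.≤ N ℕ.+ s
  ceiling-multiple s N = suc (N ℕ./ s) ,
    (begin
      N                                  ≡⟨ ℕ.m≡m%n+[m/n]*n N s ⟩
      N ℕ.% s ℕ.+ N ℕ./ s ℕ.* s          ≤⟨ ℕ.+-monoˡ-≤ _ (ℕ.m%n≤n N s) ⟩
      s ℕ.+ N ℕ./ s ℕ.* s                ∎) ,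
    (begin
      s ℕ.+ N ℕ./ s ℕ.* s                ≤⟨ ℕ.+-monoʳ-≤ s (ℕ.m/n*n≤m N s) ⟩
      s ℕ.+ N                            ≡⟨ ℕ.+-comm s N ⟩
      N ℕ.+ s                            ∎)
    where open ℕ.≤-Reasoning

  -- The excess 2PsN + Ps² is at most 3PsN, hence less than N², and Q ≥ P + 1 absorbs that.
  quadratic-gap : ∀ {P Q} s N → P ℕ.< Q → s ℕ.≤ N → 3 ℕ.* P ℕ.* s ℕ.< N →
                  P ℕ.* ((N ℕ.+ s) ℕ.* (N ℕ.+ s)) ℕ.< Q ℕ.* (N ℕ.* N)
  quadratic-gap {P} {Q} s N P<Q s≤N 3Ps<N = begin-strict
    P ℕ.* ((N ℕ.+ s) ℕ.* (N ℕ.+ s))                             ≡⟨ expand P s N ⟩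
    P ℕ.* (N ℕ.* N) ℕ.+ (P ℕ.* s ℕ.* (N ℕ.+ N) ℕ.+ P ℕ.* s ℕ.* s)
      ≤⟨ ℕ.+-monoʳ-≤ (P ℕ.* (N ℕ.* N)) (ℕ.+-monoʳ-≤ (P ℕ.* s ℕ.* (N ℕ.+ N)) (ℕ.*-monoʳ-≤ (P ℕ.* s) s≤N)) ⟩
    P ℕ.* (N ℕ.* N) ℕ.+ (P ℕ.* s ℕ.* (N ℕ.+ N) ℕ.+ P ℕ.* s ℕ.* N)
      ≡⟨ cong (P ℕ.* (N ℕ.* N) ℕ.+_) (collect P s N) ⟩
    P ℕ.* (N ℕ.* N) ℕ.+ 3 ℕ.* P ℕ.* s ℕ.* N
      <⟨ ℕ.+-monoʳ-< (P ℕ.* (N ℕ.* N)) (ℕ.*-monoˡ-< N {{ℕ.>-nonZero (ℕ.≤-<-trans ℕ.z≤n 3Ps<N)}} 3Ps<N) ⟩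
    P ℕ.* (N ℕ.* N) ℕ.+ N ℕ.* N                                 ≡⟨ ℕ.+-comm (P ℕ.* (N ℕ.* N)) (N ℕ.* N) ⟩
    suc P ℕ.* (N ℕ.* N)                                         ≤⟨ ℕ.*-monoˡ-≤ (N ℕ.* N) P<Q ⟩
    Q ℕ.* (N ℕ.* N)                                             ∎
    where
    open ℕ.≤-Reasoning
    expand : ∀ P s N → P ℕ.* ((N ℕ.+ s) ℕ.* (N ℕ.+ s)) ≡ P ℕ.* (N ℕ.* N) ℕ.+ (P ℕ.* s ℕ.* (N ℕ.+ N) ℕ.+ P ℕ.* s ℕ.* s)
    expand = ℕRing.solve-∀
    collect : ∀ P s N → P ℕ.* s ℕ.* (N ℕ.+ N) ℕ.+ P ℕ.* s ℕ.* N ≡ 3 ℕ.* P ℕ.* s ℕ.* N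
    collect = ℕRing.solve-∀

  -- A square of side N is covered by m² squares of side s with m s ≤ N + s, so the bound at s
  -- yields the exponent P (N + s)², to be compared with p′ (d + 1) N². The threshold is a sum so as
  -- to give both s ≤ N and 3Ps < N.
  settle-ℕ : ∀ s .{{_ : NonZero s}} p d p′ d′ → p ℕ.* suc d′ ℕ.< p′ ℕ.* suc d → ScaledUpper s p d →
             ∀ N → s ℕ.+ 3 ℕ.* (p ℕ.* suc d′) ℕ.* s ℕ.< N → ScaledUpper N p′ d′
  settle-ℕ s p d p′ d′ P<Q u N large with ceiling-multiple s N
  ... | m , N≤ms , ms≤N+s = ^-cancelˡ-< (suc d) (begin-strict
    (c N ℕ.^ D′) ℕ.^ D                       ≡⟨ swap-^ (c N) D′ D ⟩
    (c N ℕ.^ D) ℕ.^ D′                       ≤⟨ ℕ.^-monoˡ-≤ D′ (ℕ.^-monoˡ-≤ D (submultiplicative s m N N≤ms)) ⟩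
    ((c s ℕ.^ (m ℕ.* m)) ℕ.^ D) ℕ.^ D′       ≡⟨ cong (ℕ._^ D′) (swap-^ (c s) (m ℕ.* m) D) ⟩
    ((c s ℕ.^ D) ℕ.^ (m ℕ.* m)) ℕ.^ D′       ≤⟨ ℕ.^-monoˡ-≤ D′ (ℕ.^-monoˡ-≤ (m ℕ.* m) (ℕ.<⇒≤ u)) ⟩
    ((2 ℕ.^ (p ℕ.* (s ℕ.* s))) ℕ.^ (m ℕ.* m)) ℕ.^ D′
      ≡⟨ trans (cong (ℕ._^ D′) (ℕ.^-*-assoc 2 (p ℕ.* (s ℕ.* s)) (m ℕ.* m)))
               (ℕ.^-*-assoc 2 (p ℕ.* (s ℕ.* s) ℕ.* (m ℕ.* m)) D′) ⟩
    2 ℕ.^ (p ℕ.* (s ℕ.* s) ℕ.* (m ℕ.* m) ℕ.* D′)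
      ≡⟨ cong (2 ℕ.^_) (regroup p s m D′) ⟩
    2 ℕ.^ (P ℕ.* ((m ℕ.* s) ℕ.* (m ℕ.* s)))  ≤⟨ ℕ.^-monoʳ-≤ 2 (ℕ.*-monoʳ-≤ P (ℕ.*-mono-≤ ms≤N+s ms≤N+s)) ⟩
    2 ℕ.^ (P ℕ.* ((N ℕ.+ s) ℕ.* (N ℕ.+ s)))  <⟨ ℕ.^-monoʳ-< 2 (ℕ.n<1+n 1) (quadratic-gap s N P<Q
                                                    (ℕ.≤-trans (ℕ.m≤m+n s _) (ℕ.<⇒≤ large))
                                                    (ℕ.≤-<-trans (ℕ.m≤n+m _ s) large)) ⟩
    2 ℕ.^ (p′ ℕ.* D ℕ.* (N ℕ.* N))           ≡⟨ cong (2 ℕ.^_) (rotate p′ D (N ℕ.* N)) ⟩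
    2 ℕ.^ (p′ ℕ.* (N ℕ.* N) ℕ.* D)           ≡⟨ ℕ.^-*-assoc 2 (p′ ℕ.* (N ℕ.* N)) D ⟨
    (2 ℕ.^ (p′ ℕ.* (N ℕ.* N))) ℕ.^ D         ∎)
    where
    open ℕ.≤-Reasoning
    D = suc d
    D′ = suc d′
    P = p ℕ.* D′
    ^-cancelˡ-< : ∀ {x y} n → x ℕ.^ n ℕ.< y ℕ.^ n → x ℕ.< y
    ^-cancelˡ-< n lt = ℕ.≰⇒> λ y≤x → ℕ.<⇒≱ lt (ℕ.^-monoˡ-≤ n y≤x)
    swap-^ : ∀ x i j → (x ℕ.^ i) ℕ.^ j ≡ (x ℕ.^ j) ℕ.^ i
    swap-^ x i j = trans (ℕ.^-*-assoc x i j) (trans (cong (x ℕ.^_) (ℕ.*-comm i j)) (sym (ℕ.^-*-assoc x j i)))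
    regroup : ∀ p s m D → p ℕ.* (s ℕ.* s) ℕ.* (m ℕ.* m) ℕ.* D ≡ p ℕ.* D ℕ.* ((m ℕ.* s) ℕ.* (m ℕ.* s))
    regroup = ℕRing.solve-∀
    rotate : ∀ x y z → x ℕ.* y ℕ.* z ≡ x ℕ.* z ℕ.* y
    rotate = ℕRing.solve-∀

  settle : ∀ k {q r} → q ℚ.< r → ℝ.upper (a k) q → ∃[ N ] ∀ n → N ℕ.≤ n → ℝ.upper (a n) r
  settle k {mkℚᵘ (+ p) d} {mkℚᵘ (+ p′) d′} (*<* lt) u =
    s ℕ.+ 3 ℕ.* (p ℕ.* suc d′) ℕ.* s , λ n N≤n →
      -- `a n` concerns squares of side `suc n`, which makes the inequality with the threshold
      -- strict.
      upper⇐ n p′ d′ (settle-ℕ s p d p′ d′ P<Q (upper⇒ k p d u) (suc n) (ℕ.s≤s N≤n))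
    where
    s = suc k
    P<Q : p ℕ.* suc d′ ℕ.< p′ ℕ.* suc d
    P<Q = ℤ.drop‿+<+ (subst₂ ℤ._<_ (sym (ℤ.pos-* p (suc d′))) (sym (ℤ.pos-* p′ (suc d))) lt)
  settle k {mkℚᵘ (+ zero) d}  {mkℚᵘ -[1+ _ ] d′} (*<* ()) _
  settle k {mkℚᵘ (+ suc _) d} {mkℚᵘ -[1+ _ ] d′} (*<* ()) _

  module _ (em : ExcludedMiddle 0ℓ) (K : ℕ) (large : ∀ n → 2 ℕ.^ (n ℕ.* n) ℕ.≤ c n ℕ.^ suc K) where

    -- By `large` every term is at least 1/(K + 1), which keeps the infimum positive.
    fekete : ∃[ h ] (a ⟶ h) × Positive h
    fekete = inf , inf-limit settle , inf-positive
      where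
      1/[1+K] : ℚᵘ
      1/[1+K] = mkℚᵘ (+ 1) K
      bounded : ∀ n → ¬ ℝ.upper (a n) 1/[1+K]
      bounded n u = ℕ.<⇒≱ (upper⇒ n 1 K u)
        (subst (λ e → 2 ℕ.^ e ℕ.≤ c (suc n) ℕ.^ suc K) (sym (ℕ.*-identityˡ (suc n ℕ.* suc n))) (large (suc n)))
      open Infimum em a {1/[1+K]} (*<* (ℤ.+<+ (ℕ.s≤s ℕ.z≤n))) bounded

-- Entropy of the Kari–Culik tileset

bits : List Bool
bits = true ∷ false ∷ []

bits-unique : Unique bits
bits-unique = ((λ ()) All.∷ All.[]) ∷ (All.[] ∷ [])

nth : {S : Set} → S → ∀ {n} → Vec S n → ℕ → S
nth d []      _       = d
nth d (x ∷ v) zero    = x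
nth d (x ∷ v) (suc i) = nth d v i

nth-toℕ : ∀ {S : Set} {d : S} {n} (v : Vec S n) i → nth d v (toℕ i) ≡ lookup v i
nth-toℕ (x ∷ v) 0F       = refl
nth-toℕ (x ∷ v) (sucF i) = nth-toℕ v i

-- `Flip` expects a choice for every block of the quarter plane; the default `false` leaves the
-- blocks beyond the m × m square unchanged.
choice : ∀ {m} → Vec (Vec Bool m) m → ℕ → ℕ → Bool
choice {m} v i j = nth false (nth (Vec.replicate m false) v j) i

choice-lookup : ∀ {m} (v : Vec (Vec Bool m) m) i j → choice v (toℕ i) (toℕ j) ≡ lookup (lookup v j) i
choice-lookup v i j = trans (cong (λ u → nth false u (toℕ i)) (nth-toℕ v j)) (nth-toℕ (lookup v j) i)

flipped : ∀ {m} → Vec (Vec Bool m) m → ℤ → ℤ → WangTile VColor HColor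
flipped v = cell (Flip.flip (choice v))

flipped-injective : ∀ {m} {v v′ : Vec (Vec Bool m) m} →
  window (flipped v) (+ 0) (+ 0) (m ℕ.* 16) ≡ window (flipped v′) (+ 0) (+ 0) (m ℕ.* 16) → v ≡ v′
flipped-injective {m} {v} {v′} eq = lookup²-ext λ i j →
  trans (sym (choice-lookup v i j)) (trans
    (flip-cell-injective (choice v) (choice v′) (toℕ i) (toℕ j) (cell≡ i j)) (choice-lookup v′ i j))
  where
  cell≡ : ∀ (i j : Fin m) →
    flipped v (+ X (toℕ i) (toℕ j)) (+ Y (toℕ j)) ≡ flipped v′ (+ X (toℕ i) (toℕ j)) (+ Y (toℕ j))
  cell≡ i j = subst₂ (λ x y → flipped v (+ x) (+ y) ≡ flipped v′ (+ x) (+ y)) (Fin.toℕ-fromℕ< x<) (Fin.toℕ-fromℕ< y<)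
    (trans (sym (lookup-grid _ (fromℕ< x<) (fromℕ< y<)))
      (trans (cong (λ P → lookup (lookup P (fromℕ< y<)) (fromℕ< x<)) eq) (lookup-grid _ (fromℕ< x<) (fromℕ< y<))))
    where
    x< : X (toℕ i) (toℕ j) ℕ.< m ℕ.* 16
    x< = X<m*16 (Fin.toℕ<n i)
    y< : Y (toℕ j) ℕ.< m ℕ.* 16
    y< = Y<m*16 (Fin.toℕ<n j)

tilesPlane : TilesPlane KariCulik
tilesPlane = cell (Orbit.beatty unitRow) , cell-tiling (Orbit.beatty unitRow)

module _ (em : ExcludedMiddle 0ℓ) where
  open Counting em KariCulik

  many-patterns : ∀ m → 2 ℕ.^ (m ℕ.* m) ℕ.≤ count (m ℕ.* 16)
  many-patterns m = subst (ℕ._≤ count (m ℕ.* 16))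
    (trans (List.length-map picture (vecs (vecs bits m) m)) (length-vecs² bits m))
    (unique-⊆⇒length≤ (Unique.map⁺ flipped-injective (vecs-unique m (vecs-unique m bits-unique))) occurring)
    where
    picture : Vec (Vec Bool m) m → Vec (Vec (WangTile VColor HColor) (m ℕ.* 16)) (m ℕ.* 16)
    picture v = window (flipped v) (+ 0) (+ 0) (m ℕ.* 16)
    occurring : ∀ {P} → P ∈ map picture (vecs (vecs bits m) m) → P ∈ patterns (m ℕ.* 16)
    occurring P∈ with ∈-map⁻ picture P∈
    ... | v , _ , refl = window-∈ (cell-tiling (Flip.flip (choice v))) (+ 0) (+ 0) (m ℕ.* 16)

  -- A square of side 16k is cut into 256 squares of side k, so the count at 16k bounds the count at
  -- k from below. Thus log₂ C(k) / k² is at least 1/256 for every k ≥ 1, not only for multiples of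
  -- 16.
  count-large : ∀ k → 2 ℕ.^ (k ℕ.* k) ℕ.≤ count k ℕ.^ 256
  count-large k = ℕ.≤-trans (many-patterns k)
    (count-submultiplicative k 16 (k ℕ.* 16) (ℕ.≤-reflexive (ℕ.*-comm k 16)))

  positive-entropy : ∃[ h ] IsEntropy KariCulik h × Positive h
  positive-entropy =
    let h , limit , pos = Fekete.fekete count (count≢0 tilesPlane) count-submultiplicative em 255 count-large
    in h , (count , count≢0 tilesPlane , cardinality , limit) , pos

mainTheorem1 : TilesPlane KariCulik × (ExcludedMiddle 0ℓ → ∃[ h ] (IsEntropy KariCulik h × Positive h))
mainTheorem1 = tilesPlane , positive-entropy
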